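{- Let $\mathbb T$ be a theory and $\Gamma\in\mathsf{Ctx}$. (1) If $t\in\mathsf{Tm}^{\mathsf i}\,|\Gamma|$ is ascription-free and $\Gamma\vdash\ulcorner t\urcorner:T$, then $\Gamma\vdash t\Rightarrow U$ for some $U$ with $T\equiv U$. (2) If $t\in\mathsf{Tm}^{\mathsf c}\,|\Gamma|$ is ascription-free and $\Gamma\vdash\ulcorner t\urcorner:T$, then $\Gamma\vdash t\Leftarrow T$. (3) If $T\in\mathsf{Tm}^{\mathsf c}\,|\Gamma|$ is ascription-free and $\Gamma\vdash\ulcorner T\urcorner\ \mathsf{sort}$, then $\Gamma\vdash T\Leftarrow\mathsf{sort}$. (4) If $\mathbf t\in\mathsf{MSub}^{\mathsf c}\,|\Gamma|\,|\Xi|$ is ascription-free and $\Gamma\vdash\mathbf v,\ulcorner\mathbf t\urcorner:\Theta.\Xi$, then $\Gamma\mid\mathbf v:\Theta\vdash\mathbf t\Leftarrow\Xi$.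
   Context: **Syntax.** Expressions are taken up to renaming of bound variables (equivalently, de Bruijn indices) and implicitly weakened to larger scopes; concatenated scopes are regarded as disjoint. A scope $\gamma$ is a finite list of variables; a metavariable scope $\theta$ is a finite list of entries $\mathtt x\{\delta\}$ with $\delta$ a scope; a signature $\Sigma$ is a finite list of entries $o(\theta)$, where each operation $o$ is either a constructor (written $c$) or a destructor (written $d$). Concatenation is written with a dot, $\cdot$ is the empty list. For fixed $\Sigma$, by mutual induction: terms $\mathsf{Tm}\,\theta\,\gamma$ are $x$ ($x\in\gamma$), $\mathtt x\{\vec t\}$ ($\mathtt x\{\delta\}\in\theta$, $\vec t\in\mathsf{Sub}\,\theta\,\gamma\,\delta$), $o(\mathbf t)$ ($o(\xi)\in\Sigma$, $\mathbf t\in\mathsf{MSub}\,\theta\,\gamma\,\xi$); substitutions $\mathsf{Sub}\,\theta\,\gamma\,\delta$ are lists of terms in $\mathsf{Tm}\,\theta\,\gamma$, one $t_x$ for each $x\in\delta$; metavariable substitutions $\mathsf{MSub}\,\theta\,\gamma\,\xi$ are lists with one entry $\vec x_\delta.t$, $t\in\mathsf{Tm}\,\theta\,(\gamma.\delta)$ (variables of $\delta$ bound), for each $\mathtt x\{\delta\}\in\xi$, and $\mathbf t_{\mathtt x}$ denotes this $t$; $\varepsilon$ is the empty list. $\mathsf{Ctx}\,\theta\,\gamma$: lists $x_1:T_1,\dots,x_k:T_k$ with $T_i\in\mathsf{Tm}\,\theta\,(\gamma,x_1,\dots,x_{i-1})$; underlying scope $|\Gamma|=x_1,\dots,x_k$.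 $\mathsf{MCtx}\,\theta$: lists $\mathtt x_1\{\Gamma_1\}:T_1,\dots,\mathtt x_k\{\Gamma_k\}:T_k$ with $\Gamma_i\in\mathsf{Ctx}\,(\theta.\xi_i)\,(\cdot)$ and $T_i\in\mathsf{Tm}\,(\theta.\xi_i)\,|\Gamma_i|$, where $\xi_i=\mathtt x_1\{|\Gamma_1|\},\dots,\mathtt x_{i-1}\{|\Gamma_{i-1}|\}$; $|\Theta|=\mathtt x_1\{|\Gamma_1|\},\dots,\mathtt x_k\{|\Gamma_k|\}$. Abbreviate $\mathsf{Ctx}\,\theta=\mathsf{Ctx}\,\theta\,(\cdot)$, $\mathsf{Ctx}=\mathsf{Ctx}\,(\cdot)\,(\cdot)$, $\mathsf{MCtx}=\mathsf{MCtx}\,(\cdot)$. $\mathsf{id}_\gamma$ is the list of variables of $\gamma$; $\mathsf{id}_\theta\in\mathsf{MSub}\,\theta\,(\cdot)\,\theta$ has entry $\vec x_\delta.\mathtt x\{\mathsf{id}_\delta\}$ for each $\mathtt x\{\delta\}\in\theta$. For $\vec v\in\mathsf{Sub}\,\theta\,\gamma_1\,\gamma_2$ and $e$ over $\theta,\gamma_2$, $e[\vec v]$ (over $\theta,\gamma_1$) is capture-avoiding simultaneous substitution. For $\mathbf v\in\mathsf{MSub}\,\theta_1\,\delta\,\theta_2$ and $e$ over $\theta_2,\gamma$, $e[\mathbf v]$ (over $\theta_1,\delta.\gamma$) is defined structurally by $x[\mathbf v]=x$, $\mathtt x\{\vec t\}[\mathbf v]=\mathbf v_{\mathtt x}[\mathsf{id}_\delta,\vec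 t[\mathbf v]]$, $o(\mathbf t)[\mathbf v]=o(\mathbf t[\mathbf v])$, componentwise on lists and contexts. **Patterns and theories.** $\mathsf{Tm}^{\mathsf P}\,\theta\,\gamma$: $\mathtt x\{\mathsf{id}_\gamma\}$ if $\theta$ is exactly $\mathtt x\{\gamma\}$; or $c(\mathbf t)$ with $c(\xi)\in\Sigma$ a constructor and $\mathbf t\in\mathsf{MSub}^{\mathsf P}\,\theta\,\gamma\,\xi$. $\mathsf{MSub}^{\mathsf P}\,\theta\,\gamma\,\xi$: $\varepsilon$ if $\xi=\theta=\cdot$; or $\mathbf t,\vec x_\delta.t$ if $\xi=\xi',\mathtt x\{\delta\}$, $\theta=\theta_1.\theta_2$, $\mathbf t\in\mathsf{MSub}^{\mathsf P}\,\theta_1\,\gamma\,\xi'$, $t\in\mathsf{Tm}^{\mathsf P}\,\theta_2\,(\gamma.\delta)$. A theory $\mathbb T$, with underlying signature $|\mathbb T|$, is built from the empty theory by successively adding entries over the current signature (declared symbols pairwise distinct): sort rules $c(\Xi)\ \mathsf{sort}$ with $\Xi\in\mathsf{MCtx}$ (adds $c(|\Xi|)$ to the signature); constructor rules $c(\Xi_p;\Xi_c;\mathbf v_i/\Xi_i):T$ with $\Xi_p\in\mathsf{MCtx}$, $\Xi_c,\Xi_i\in\mathsf{MCtx}\,|\Xi_p|$, $\mathbf v_i\in\mathsf{MSub}\,|\Xi_p.\Xi_c|\,(\cdot)\,|\Xi_i|$, $T\in\mathsf{Tm}^{\mathsf P}\,|\Xi_p.\Xi_i|\,(\cdot)$ (adds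 $c(|\Xi_c|)$); destructor rules $d(\Xi_{pi};\mathtt x:T;\Xi_d):U$ with $\Xi_{pi}\in\mathsf{MCtx}$, $T\in\mathsf{Tm}^{\mathsf P}\,|\Xi_{pi}|\,(\cdot)$, $\Xi_d\in\mathsf{MCtx}\,|\Xi_{pi},\mathtt x:T|$, $U\in\mathsf{Tm}\,|\Xi_{pi}.(\mathtt x:T).\Xi_d|\,(\cdot)$ (adds $d(\mathtt x,|\Xi_d|)$); rewrite rules $\theta\Vdash d(\mathbf t)\longmapsto r$ with $d(\xi)\in|\mathbb T|$, $\mathbf t\in\mathsf{MSub}^{\mathsf P}\,\theta\,(\cdot)\,\xi$, $r\in\mathsf{Tm}\,\theta\,(\cdot)$, such that $\mathbf t[\mathbf u]\ne\mathbf t'[\mathbf u']$ for every earlier rule $\theta'\Vdash d(\mathbf t')\longmapsto r'$ and all $\mathbf u,\mathbf u'$. The relation $\longrightarrow$ is the closure under all expression formers (one component at a time, also under binders and in contexts) of $d(\mathbf u[\mathbf t])\longrightarrow r[\mathbf t]$ for $(\theta_0\Vdash d(\mathbf u)\longmapsto r)\in\mathbb T$, $\mathbf t\in\mathsf{MSub}\,\theta\,\gamma\,\theta_0$; $\longrightarrow^*$ and $\equiv$ are its reflexive-transitive and reflexive-symmetric-transitive closures. **Declarative typing** (inductively defined; $\Theta\in\mathsf{MCtx}$, $\Gamma,\Delta\in\mathsf{Ctx}\,|\Theta|$, $\Xi\in\mathsf{MCtx}$). $\cdot\vdash$; $\Theta,\mathtt x\{\Gamma\}:T\vdash$ if $\Theta;\Gamma\vdash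 T\ \mathsf{sort}$. $\Theta;\cdot\vdash$ if $\Theta\vdash$; $\Theta;\Gamma,x:T\vdash$ if $\Theta;\Gamma\vdash T\ \mathsf{sort}$. Sort: $\Theta;\Gamma\vdash c(\mathbf t)\ \mathsf{sort}$ if $c(\Xi)\ \mathsf{sort}\in\mathbb T$ and $\Theta;\Gamma\vdash\mathbf t:\Xi$. Var: $\Theta;\Gamma\vdash x:T$ if $x:T\in\Gamma$ and $\Theta;\Gamma\vdash$. MVar: $\Theta;\Gamma\vdash\mathtt x\{\vec t\}:T[\vec t]$ if $\mathtt x\{\Delta\}:T\in\Theta$ and $\Theta;\Gamma\vdash\vec t:\Delta$. Cons: $\Theta;\Gamma\vdash c(\mathbf t):T[\mathbf t_p,\mathbf v_i[\mathbf t_p,\mathbf t]]$ if $c(\Xi_p;\Xi_c;\mathbf v_i/\Xi_i):T\in\mathbb T$, $\Theta;\Gamma\vdash\mathbf t_p,\mathbf t:\Xi_p.\Xi_c$ and $\Theta;\Gamma\vdash T[\mathbf t_p,\mathbf v_i[\mathbf t_p,\mathbf t]]\ \mathsf{sort}$. Dest: $\Theta;\Gamma\vdash d(\mathbf t):U[\mathbf t_{pi},\mathbf t]$ if $d(\Xi_{pi};\mathtt x:T;\Xi_d):U\in\mathbb T$ and $\Theta;\Gamma\vdash\mathbf t_{pi},\mathbf t:\Xi_{pi}.(\mathtt x:T).\Xi_d$. Conv: $\Theta;\Gamma\vdash t:U$ if $\Theta;\Gamma\vdash t:T$, $T\equiv U$, $\Theta;\Gamma\vdash U\ \mathsf{sort}$.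 Substitutions: $\Theta;\Gamma\vdash\varepsilon:(\cdot)$ if $\Theta;\Gamma\vdash$; $\Theta;\Gamma\vdash\vec t,t:(\Delta,x:T)$ if $\Theta;\Gamma\vdash\vec t:\Delta$ and $\Theta;\Gamma\vdash t:T[\vec t]$. Metavariable substitutions: $\Theta;\Gamma\vdash\varepsilon:(\cdot)$ if $\Theta;\Gamma\vdash$; $\Theta;\Gamma\vdash\mathbf t,\vec x_\Delta.t:(\Xi,\mathtt x\{\Delta\}:T)$ if $\Theta;\Gamma\vdash\mathbf t:\Xi$ and $\Theta;\Gamma.\Delta[\mathbf t]\vdash t:T[\mathbf t]$. One writes $\Gamma\vdash\mathcal J$ for $\cdot;\Gamma\vdash\mathcal J$ and $\Theta\vdash\mathcal J$ for $\Theta;\cdot\vdash\mathcal J$. **Matching.** For $t\in\mathsf{Tm}^{\mathsf P}\,\theta\,\gamma$, $u\in\mathsf{Tm}\,(\cdot)\,(\delta.\gamma)$, $\mathbf v\in\mathsf{MSub}\,(\cdot)\,\delta\,\theta$ the judgment $t\prec u\leadsto\mathbf v$ (and similarly $\mathbf t\prec\mathbf u\leadsto\mathbf v$) is defined by: $c(\mathbf t)\prec u\leadsto\mathbf v$ if $u\longrightarrow^*c(\mathbf u)$ and $\mathbf t\prec\mathbf u\leadsto\mathbf v$; $\mathtt x\{\mathsf{id}_\gamma\}\prec u\leadsto\vec x_\gamma.u$; $\varepsilon\prec\varepsilon\leadsto\varepsilon$; $(\mathbf t,\vec x.t)\prec(\mathbf u,\vec x.u)\leadsto\mathbf v_1,\mathbf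 v_2$ if $\mathbf t\prec\mathbf u\leadsto\mathbf v_1$ and $t\prec u\leadsto\mathbf v_2$. **Bidirectional syntax.** Checkable terms $\mathsf{Tm}^{\mathsf c}\,\gamma$: $c(\mathbf t)$ with $c(\xi)\in\Sigma$, $\mathbf t\in\mathsf{MSub}^{\mathsf c}\,\gamma\,\xi$; or $\underline t$ with $t\in\mathsf{Tm}^{\mathsf i}\,\gamma$. Inferable terms $\mathsf{Tm}^{\mathsf i}\,\gamma$: $x\in\gamma$; $d(t,\mathbf t)$ with $d(\mathtt x,\xi)\in\Sigma$, $t\in\mathsf{Tm}^{\mathsf i}\,\gamma$, $\mathbf t\in\mathsf{MSub}^{\mathsf c}\,\gamma\,\xi$; ascriptions $t::T$ with $t,T\in\mathsf{Tm}^{\mathsf c}\,\gamma$. $\mathsf{MSub}^{\mathsf c}\,\gamma\,\xi$: lists with one entry $\vec x_\delta.t$, $t\in\mathsf{Tm}^{\mathsf c}\,(\gamma.\delta)$, for each $\mathtt x\{\delta\}\in\xi$. $\ulcorner-\urcorner$ is the underlying ordinary expression (over the empty metavariable scope): it erases underlining and ascriptions ($\ulcorner t::T\urcorner=\ulcorner t\urcorner$, $\ulcorner\underline t\urcorner=\ulcorner t\urcorner$). A bidirectional expression is ascription-free if it contains no occurrence of $t::T$. **Bidirectional typing** (inductively defined; $\Gamma\in\mathsf{Ctx}$). In $\Gamma\vdash t\Leftarrow T$ and $\Gamma\vdash t\Rightarrow T$ we have $T\in\mathsf{Tm}\,(\cdot)\,|\Gamma|$ and $t$ checkable, resp. inferable;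 in $\Gamma\vdash T\Leftarrow\mathsf{sort}$, $T$ is checkable; in $\Gamma\mid\mathbf v:\Theta\vdash\mathbf t\Leftarrow\Xi$, $\Theta\in\mathsf{MCtx}$, $\mathbf v\in\mathsf{MSub}\,(\cdot)\,|\Gamma|\,|\Theta|$, $\Xi\in\mathsf{MCtx}\,|\Theta|$, $\mathbf t\in\mathsf{MSub}^{\mathsf c}\,|\Gamma|\,|\Xi|$. Rules. Sort: $\Gamma\vdash c(\mathbf t)\Leftarrow\mathsf{sort}$ if $c(\Xi)\ \mathsf{sort}\in\mathbb T$ and $\Gamma\mid\varepsilon:(\cdot)\vdash\mathbf t\Leftarrow\Xi$. Cons: $\Gamma\vdash c(\mathbf u)\Leftarrow T'$ if $c(\Xi_p;\Xi_c;\mathbf v_i/\Xi_i):T\in\mathbb T$, $T\prec T'\leadsto\mathbf t_p,\mathbf t_i$, $\Gamma\mid\mathbf t_p:\Xi_p\vdash\mathbf u\Leftarrow\Xi_c$ and $\mathbf t_i\equiv\mathbf v_i[\mathbf t_p,\ulcorner\mathbf u\urcorner]$. Switch: $\Gamma\vdash\underline t\Leftarrow U$ if $\Gamma\vdash t\Rightarrow T$ and $T\equiv U$. Var: $\Gamma\vdash x\Rightarrow T$ if $x:T\in\Gamma$. Annot: $\Gamma\vdash t::T\Rightarrow\ulcorner T\urcorner$ if $\Gamma\vdash T\Leftarrow\mathsf{sort}$ and $\Gamma\vdash t\Leftarrow\ulcorner T\urcorner$. Dest: $\Gamma\vdash d(t,\mathbf u)\Rightarrow U[\mathbf t,\ulcorner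 t\urcorner,\ulcorner\mathbf u\urcorner]$ if $d(\Xi_{pi};\mathtt x:T;\Xi_d):U\in\mathbb T$, $\Gamma\vdash t\Rightarrow T'$, $T\prec T'\leadsto\mathbf t$ and $\Gamma\mid\mathbf t,\ulcorner t\urcorner:(\Xi_{pi},\mathtt x:T)\vdash\mathbf u\Leftarrow\Xi_d$. EmptyMSub: $\Gamma\mid\mathbf v:\Theta\vdash\varepsilon\Leftarrow(\cdot)$. ExtMSub: $\Gamma\mid\mathbf v:\Theta\vdash\mathbf t,\vec x_\Delta.t\Leftarrow(\Xi,\mathtt x\{\Delta\}:T)$ if $\Gamma\mid\mathbf v:\Theta\vdash\mathbf t\Leftarrow\Xi$ and $\Gamma.\Delta[\mathbf v,\ulcorner\mathbf t\urcorner]\vdash t\Leftarrow T[\mathbf v,\ulcorner\mathbf t\urcorner]$. -}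

module Defs where

open import Data.Empty using (⊥)
open import Data.Fin using (Fin; zero; suc; _↑ˡ_; _↑ʳ_; splitAt; cast)
open import Data.List using (List; []; _∷_; _++_; map)
open import Data.List.Membership.Propositional using (_∈_)
open import Data.List.Membership.Propositional.Properties using (∈-++⁺ˡ; ∈-++⁺ʳ)
open import Data.List.Relation.Unary.Any using (here; there)
open import Data.Nat using (ℕ; zero; suc; _+_)
open import Data.Nat.Properties using (+-assoc)
open import Data.Product using (_×_)
open import Data.Sum using ([_,_]′)
open import Data.Unit using (⊤)
open import Function using (_∘_)
open import Relation.Binary.Construct.Closure.Equivalence using (EqClosure)
open import Relation.Binary.Construct.Closure.ReflexiveTransitive using (Star)
open import Relation.Binary.PropositionalEquality using (_≡_; refl; sym)
open import Relation.Nullary using (¬_)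

-- Everything is well-scoped de Bruijn, with the most recent entry first.
-- A variable scope is therefore its length, and the concatenation γ.δ of
-- the paper (δ to the right of γ) is  δ + γ;  likewise the concatenation
-- θ.ξ of metavariable scopes is  ξ ++ θ.  With this orientation
-- (γ.δ),x = γ.(δ,x)  and  θ.(ξ,x{δ}) = (θ.ξ),x{δ}  hold definitionally.

Scope : Set
Scope = ℕ

MScope : Set
MScope = List Scope

-- con ξ is a constructor c(ξ).  des ξ is a destructor d(x,ξ): every
-- destructor of a theory has a first, "principal" argument x{·}, which is
-- kept apart from the remaining arguments ξ throughout.
data Entry : Set where
  con des : MScope → Entry

Sig : Set
Sig = List Entry

variable
  S           : Sig
  e           : Entry
  γ γ′ γ″ δ δ′ : Scope
  θ θ′ θ₁ θ₂ ξ : MScope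

infixl 5 _▸_ _▸_∶_

mutual
  data Tm (S : Sig) (θ : MScope) (γ : Scope) : Set where
    var  : Fin γ → Tm S θ γ
    mvar : δ ∈ θ → Sub S θ γ δ → Tm S θ γ
    con  : con ξ ∈ S → MSub S θ γ ξ → Tm S θ γ
    des  : des ξ ∈ S → Tm S θ γ → MSub S θ γ ξ → Tm S θ γ

  data Sub (S : Sig) (θ : MScope) (γ : Scope) : Scope → Set where
    ε   : Sub S θ γ zero
    _▸_ : Sub S θ γ δ → Tm S θ γ → Sub S θ γ (suc δ)

  data MSub (S : Sig) (θ : MScope) (γ : Scope) : MScope → Set where
    ε   : MSub S θ γ []
    _▸_ : MSub S θ γ ξ → Tm S θ (δ + γ) → MSub S θ γ (δ ∷ ξ)

-- Ctx S θ γ γ′ consists of the Γ ∈ Ctx θ γ with γ.|Γ| = γ′.  In particular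
-- Ctx S θ 0 γ consists of the Γ ∈ Ctx θ (·) with |Γ| = γ.
data Ctx (S : Sig) (θ : MScope) (γ : Scope) : Scope → Set where
  ε   : Ctx S θ γ γ
  _▸_ : Ctx S θ γ δ → Tm S θ δ → Ctx S θ γ (suc δ)

-- MCtx S θ consists of the Θ ∈ MCtx (·) with |Θ| = θ.
data MCtx (S : Sig) : MScope → Set where
  ε     : MCtx S []
  _▸_∶_ : MCtx S θ → Ctx S θ 0 δ → Tm S θ δ → MCtx S (δ ∷ θ)

-- MTel S θ ξ consists of the Ξ ∈ MCtx θ with |Ξ| = ξ.  The elements of
-- MCtx S ξ and MTel S [] ξ are the same lists; the two types are
-- distinguished only because  ξ ++ []  is not definitionally  ξ.
data MTel (S : Sig) (θ : MScope) : MScope → Set where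
  ε     : MTel S θ []
  _▸_∶_ : MTel S θ ξ → Ctx S (ξ ++ θ) 0 δ → Tm S (ξ ++ θ) δ → MTel S θ (δ ∷ ξ)

infixl 6 _⊹_ _⊹ᶜ_ _⊹ˣ_

_⊹_ : MSub S θ γ θ₁ → MSub S θ γ ξ → MSub S θ γ (ξ ++ θ₁)
v ⊹ ε        = v
v ⊹ (ts ▸ t) = (v ⊹ ts) ▸ t

_⊹ᶜ_ : Ctx S θ γ γ′ → Ctx S θ γ′ γ″ → Ctx S θ γ γ″
Γ ⊹ᶜ ε       = Γ
Γ ⊹ᶜ (Δ ▸ T) = (Γ ⊹ᶜ Δ) ▸ T

_⊹ˣ_ : MCtx S θ → MTel S θ ξ → MCtx S (ξ ++ θ)
Θ ⊹ˣ ε           = Θ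
Θ ⊹ˣ (Ξ ▸ Δ ∶ T) = (Θ ⊹ˣ Ξ) ▸ Δ ∶ T

mutual
  wkTm : Tm S θ γ → Tm (e ∷ S) θ γ
  wkTm (var x)      = var x
  wkTm (mvar x ts)  = mvar x (wkSub ts)
  wkTm (con c ts)   = con (there c) (wkMSub ts)
  wkTm (des d t ts) = des (there d) (wkTm t) (wkMSub ts)

  wkSub : Sub S θ γ δ → Sub (e ∷ S) θ γ δ
  wkSub ε        = ε
  wkSub (ts ▸ t) = wkSub ts ▸ wkTm t

  wkMSub : MSub S θ γ ξ → MSub (e ∷ S) θ γ ξ
  wkMSub ε        = ε
  wkMSub (ts ▸ t) = wkMSub ts ▸ wkTm t

wkCtx : Ctx S θ γ δ → Ctx (e ∷ S) θ γ δ
wkCtx ε       = ε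
wkCtx (Γ ▸ T) = wkCtx Γ ▸ wkTm T

wkMCtx : MCtx S θ → MCtx (e ∷ S) θ
wkMCtx ε           = ε
wkMCtx (Θ ▸ Δ ∶ T) = wkMCtx Θ ▸ wkCtx Δ ∶ wkTm T

wkMTel : MTel S θ ξ → MTel (e ∷ S) θ ξ
wkMTel ε           = ε
wkMTel (Ξ ▸ Δ ∶ T) = wkMTel Ξ ▸ wkCtx Δ ∶ wkTm T

Ren : Scope → Scope → Set
Ren γ γ′ = Fin γ → Fin γ′

liftRen : ∀ δ → Ren γ γ′ → Ren (δ + γ) (δ + γ′)
liftRen {γ′ = γ′} δ ρ = [ _↑ˡ γ′ , (δ ↑ʳ_) ∘ ρ ]′ ∘ splitAt δ

mutual
  ren : Ren γ γ′ → Tm S θ γ → Tm S θ γ′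
  ren ρ (var x)      = var (ρ x)
  ren ρ (mvar x ts)  = mvar x (renSub ρ ts)
  ren ρ (con c ts)   = con c (renMSub ρ ts)
  ren ρ (des d t ts) = des d (ren ρ t) (renMSub ρ ts)

  renSub : Ren γ γ′ → Sub S θ γ δ → Sub S θ γ′ δ
  renSub ρ ε        = ε
  renSub ρ (ts ▸ t) = renSub ρ ts ▸ ren ρ t

  renMSub : Ren γ γ′ → MSub S θ γ ξ → MSub S θ γ′ ξ
  renMSub ρ ε                = ε
  renMSub ρ (_▸_ {δ = δ} ts t) = renMSub ρ ts ▸ ren (liftRen δ ρ) t

lookupSub : Sub S θ γ δ → Fin δ → Tm S θ γ
lookupSub (ts ▸ t) zero    = t
lookupSub (ts ▸ t) (suc x) = lookupSub ts x

tabulateSub : (Fin δ → Tm S θ γ) → Sub S θ γ δ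
tabulateSub {δ = zero}  f = ε
tabulateSub {δ = suc δ} f = tabulateSub (f ∘ suc) ▸ f zero

idSub : Sub S θ γ γ
idSub = tabulateSub var

liftSub : ∀ δ → (Fin γ → Tm S θ γ′) → Fin (δ + γ) → Tm S θ (δ + γ′)
liftSub {γ′ = γ′} δ σ = [ (λ x → var (x ↑ˡ γ′)) , ren (δ ↑ʳ_) ∘ σ ]′ ∘ splitAt δ

mutual
  sub : (Fin γ → Tm S θ γ′) → Tm S θ γ → Tm S θ γ′
  sub σ (var x)      = σ x
  sub σ (mvar x ts)  = mvar x (subSub σ ts)
  sub σ (con c ts)   = con c (subMSub σ ts)
  sub σ (des d t ts) = des d (sub σ t) (subMSub σ ts)

  subSub : (Fin γ → Tm S θ γ′) → Sub S θ γ δ → Sub S θ γ′ δ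
  subSub σ ε        = ε
  subSub σ (ts ▸ t) = subSub σ ts ▸ sub σ t

  subMSub : (Fin γ → Tm S θ γ′) → MSub S θ γ ξ → MSub S θ γ′ ξ
  subMSub σ ε                = ε
  subMSub σ (_▸_ {δ = δ} ts t) = subMSub σ ts ▸ sub (liftSub δ σ) t

infix 8 _[_]ˢ _[_] _[_]ᵐ _[_]ᶜ

_[_]ˢ : Tm S θ δ → Sub S θ γ δ → Tm S θ γ
t [ ts ]ˢ = sub (lookupSub ts) t

MRen : MScope → MScope → Set
MRen θ θ′ = ∀ {δ} → δ ∈ θ → δ ∈ θ′

mutual
  mren : MRen θ θ′ → Tm S θ γ → Tm S θ′ γ
  mren ρ (var x)      = var x
  mren ρ (mvar x ts)  = mvar (ρ x) (mrenSub ρ ts)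
  mren ρ (con c ts)   = con c (mrenMSub ρ ts)
  mren ρ (des d t ts) = des d (mren ρ t) (mrenMSub ρ ts)

  mrenSub : MRen θ θ′ → Sub S θ γ δ → Sub S θ′ γ δ
  mrenSub ρ ε        = ε
  mrenSub ρ (ts ▸ t) = mrenSub ρ ts ▸ mren ρ t

  mrenMSub : MRen θ θ′ → MSub S θ γ ξ → MSub S θ′ γ ξ
  mrenMSub ρ ε        = ε
  mrenMSub ρ (ts ▸ t) = mrenMSub ρ ts ▸ mren ρ t

mrenCtx : MRen θ θ′ → Ctx S θ γ γ′ → Ctx S θ′ γ γ′
mrenCtx ρ ε       = ε
mrenCtx ρ (Γ ▸ T) = mrenCtx ρ Γ ▸ mren ρ T

lookupMSub : MSub S θ γ ξ → δ ∈ ξ → Tm S θ (δ + γ)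
lookupMSub (ts ▸ t) (here refl) = t
lookupMSub (ts ▸ t) (there x)   = lookupMSub ts x

-- msub v ρ τ e is e[v], for v over δ and e over γ, with result in any scope
-- γ′ into which both δ (by ρ) and γ (by τ) embed.  Taking γ′ = δ.γ gives the
-- e[v] of the paper (_[_] below); the general form avoids having to
-- reassociate  δ.(γ.δ′)  to  (δ.γ).δ′  under binders.
mutual
  msub : MSub S θ′ δ θ → Ren δ γ′ → Ren γ γ′ → Tm S θ γ → Tm S θ′ γ′
  msub v ρ τ (var x)               = var (τ x)
  msub v ρ τ (mvar {δ = δ} x ts)   =
    sub ([ lookupSub (msubSub v ρ τ ts) , var ∘ ρ ]′ ∘ splitAt δ) (lookupMSub v x)
  msub v ρ τ (con c ts)            = con c (msubMSub v ρ τ ts)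
  msub v ρ τ (des d t ts)          = des d (msub v ρ τ t) (msubMSub v ρ τ ts)

  msubSub : MSub S θ′ δ θ → Ren δ γ′ → Ren γ γ′ → Sub S θ γ δ′ → Sub S θ′ γ′ δ′
  msubSub v ρ τ ε        = ε
  msubSub v ρ τ (ts ▸ t) = msubSub v ρ τ ts ▸ msub v ρ τ t

  msubMSub : MSub S θ′ δ θ → Ren δ γ′ → Ren γ γ′ → MSub S θ γ ξ → MSub S θ′ γ′ ξ
  msubMSub v ρ τ ε                  = ε
  msubMSub v ρ τ (_▸_ {δ = δ} ts t) =
    msubMSub v ρ τ ts ▸ msub v ((δ ↑ʳ_) ∘ ρ) (liftRen δ τ) t

_[_] : Tm S θ γ → MSub S θ′ δ θ → Tm S θ′ (γ + δ)
_[_] {γ = γ} {δ = δ} t v = msub v (γ ↑ʳ_) (_↑ˡ δ) t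

_[_]ᵐ : MSub S θ γ ξ → MSub S θ′ δ θ → MSub S θ′ (γ + δ) ξ
_[_]ᵐ {γ = γ} {δ = δ} ts v = msubMSub v (γ ↑ʳ_) (_↑ˡ δ) ts

_[_]ᶜ : Ctx S θ γ γ′ → MSub S θ′ δ θ → Ctx S θ′ (γ + δ) (γ′ + δ)
ε       [ v ]ᶜ = ε
(Γ ▸ T) [ v ]ᶜ = (Γ [ v ]ᶜ) ▸ (T [ v ])

mutual
  data TmP (S : Sig) : MScope → Scope → Set where
    mvar : TmP S (γ ∷ []) γ
    con  : con ξ ∈ S → MSubP S θ γ ξ → TmP S θ γ

  data MSubP (S : Sig) : MScope → Scope → MScope → Set where
    ε   : MSubP S [] γ []
    _▸_ : MSubP S θ₁ γ ξ → TmP S θ₂ (δ + γ) → MSubP S (θ₂ ++ θ₁) γ (δ ∷ ξ)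

mutual
  ⌊_⌋ : TmP S θ γ → Tm S θ γ
  ⌊ mvar ⌋     = mvar (here refl) idSub
  ⌊ con c ts ⌋ = con c ⌊ ts ⌋ᵐ

  ⌊_⌋ᵐ : MSubP S θ γ ξ → MSub S θ γ ξ
  ⌊ ε ⌋ᵐ                   = ε
  ⌊ _▸_ {θ₂ = θ₂} ts t ⌋ᵐ = mrenMSub (∈-++⁺ʳ θ₂) ⌊ ts ⌋ᵐ ▸ mren ∈-++⁺ˡ ⌊ t ⌋

mutual
  wkTmP : TmP S θ γ → TmP (e ∷ S) θ γ
  wkTmP mvar       = mvar
  wkTmP (con c ts) = con (there c) (wkMSubP ts)

  wkMSubP : MSubP S θ γ ξ → MSubP (e ∷ S) θ γ ξ
  wkMSubP ε        = ε
  wkMSubP (ts ▸ t) = wkMSubP ts ▸ wkTmP t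

-- Both sort rules and constructor rules declare constructors.
data Decl (S : Sig) : Entry → Set where
  sort : (Ξ : MTel S [] ξ) → Decl S (con ξ)

  cons : ∀ {θp ξc ξi}
         (Ξp : MCtx S θp) (Ξc : MTel S θp ξc)
         (vi : MSub S (ξc ++ θp) 0 ξi) (Ξi : MTel S θp ξi)
         (T : TmP S (ξi ++ θp) 0) →
         Decl S (con ξc)

  dest : ∀ {θpi ξd}
         (Ξpi : MCtx S θpi) (T : TmP S θpi 0) (Ξd : MTel S (0 ∷ θpi) ξd)
         (U : Tm S (ξd ++ 0 ∷ θpi) 0) →
         Decl S (des ξd)

wkDecl : ∀ {e′} → Decl S e′ → Decl (e ∷ S) e′
wkDecl (sort Ξ)            = sort (wkMTel Ξ)
wkDecl (cons Ξp Ξc vi Ξi T) =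
  cons (wkMCtx Ξp) (wkMTel Ξc) (wkMSub vi) (wkMTel Ξi) (wkTmP T)
wkDecl (dest Ξpi T Ξd U)   = dest (wkMCtx Ξpi) (wkTmP T) (wkMTel Ξd) (wkTm U)

-- A rewrite rule  θ ⊩ d(t,ts) ⟼ r.  As t and ts together form the list of
-- patterns of d(x,ξ), the scope θ is split between them.
record Rewrite (S : Sig) : Set where
  constructor rewr
  field
    {arity}   : MScope
    {θt θts}  : MScope
    symbol    : des arity ∈ S
    principal : TmP S θt 0
    arguments : MSubP S θts 0 arity
    rhs       : Tm S (θts ++ θt) 0

  scope : MScope
  scope = θts ++ θt

  lhs : Tm S scope 0
  lhs = des symbol (mren (∈-++⁺ʳ θts) ⌊ principal ⌋) (mrenMSub ∈-++⁺ˡ ⌊ arguments ⌋ᵐ)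

open Rewrite public using (scope; lhs; rhs)

wkRewrite : Rewrite S → Rewrite (e ∷ S)
wkRewrite (rewr d t ts r) = rewr (there d) (wkTmP t) (wkMSubP ts) (wkTm r)

NonOverlapping : Rewrite S → Rewrite S → Set
NonOverlapping {S} R R′ =
  ∀ {θ δ} (u : MSub S θ δ (scope R)) (u′ : MSub S θ δ (scope R′)) →
  ¬ (lhs R [ u ] ≡ lhs R′ [ u′ ])

-- Theory S consists of the theories with underlying signature S.  Symbols
-- are positions in S, so declared symbols are automatically distinct.
mutual
  data Theory : Sig → Set where
    ∅       : Theory []
    declare : Theory S → Decl S e → Theory (e ∷ S)
    rewrite-rule : (𝕋 : Theory S) (R : Rewrite S) →
                   (∀ R′ → R′ ∈ rewrites 𝕋 → NonOverlapping R R′) →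
                   Theory S

  rewrites : Theory S → List (Rewrite S)
  rewrites ∅                    = []
  rewrites (declare 𝕋 D)        = map wkRewrite (rewrites 𝕋)
  rewrites (rewrite-rule 𝕋 R _) = R ∷ rewrites 𝕋

declaration : Theory S → e ∈ S → Decl S e
declaration (declare 𝕋 D)        (here refl) = wkDecl D
declaration (declare 𝕋 D)        (there o)   = wkDecl (declaration 𝕋 o)
declaration (rewrite-rule 𝕋 R _) o           = declaration 𝕋 o

lookupVar : Ctx S θ 0 γ → Fin γ → Tm S θ γ
lookupVar (Γ ▸ T) zero    = ren suc T
lookupVar (Γ ▸ T) (suc x) = ren suc (lookupVar Γ x)

lookupMCtx : MCtx S θ → δ ∈ θ → Ctx S θ 0 δ
lookupMCtx (Θ ▸ Δ ∶ T) (here refl) = mrenCtx there Δ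
lookupMCtx (Θ ▸ Δ ∶ T) (there x)   = mrenCtx there (lookupMCtx Θ x)

lookupMTy : MCtx S θ → δ ∈ θ → Tm S θ δ
lookupMTy (Θ ▸ Δ ∶ T) (here refl) = mren there T
lookupMTy (Θ ▸ Δ ∶ T) (there x)   = mren there (lookupMTy Θ x)

infix 7 _∷∷_

mutual
  data TmC (S : Sig) (γ : Scope) : Set where
    con      : con ξ ∈ S → MSubC S γ ξ → TmC S γ
    underline : TmI S γ → TmC S γ

  data TmI (S : Sig) (γ : Scope) : Set where
    var  : Fin γ → TmI S γ
    des  : des ξ ∈ S → TmI S γ → MSubC S γ ξ → TmI S γ
    _∷∷_ : TmC S γ → TmC S γ → TmI S γ

  data MSubC (S : Sig) (γ : Scope) : MScope → Set where
    ε   : MSubC S γ []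
    _▸_ : MSubC S γ ξ → TmC S (δ + γ) → MSubC S γ (δ ∷ ξ)

mutual
  ⌜_⌝ᶜ : TmC S γ → Tm S [] γ
  ⌜ con c ts ⌝ᶜ    = con c ⌜ ts ⌝ᵐ
  ⌜ underline t ⌝ᶜ = ⌜ t ⌝ⁱ

  ⌜_⌝ⁱ : TmI S γ → Tm S [] γ
  ⌜ var x ⌝ⁱ      = var x
  ⌜ des d t ts ⌝ⁱ = des d ⌜ t ⌝ⁱ ⌜ ts ⌝ᵐ
  ⌜ t ∷∷ T ⌝ⁱ     = ⌜ t ⌝ᶜ

  ⌜_⌝ᵐ : MSubC S γ ξ → MSub S [] γ ξ
  ⌜ ε ⌝ᵐ      = ε
  ⌜ ts ▸ t ⌝ᵐ = ⌜ ts ⌝ᵐ ▸ ⌜ t ⌝ᶜ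

mutual
  AscFreeᶜ : TmC S γ → Set
  AscFreeᶜ (con c ts)    = AscFreeᵐ ts
  AscFreeᶜ (underline t) = AscFreeⁱ t

  AscFreeⁱ : TmI S γ → Set
  AscFreeⁱ (var x)      = ⊤
  AscFreeⁱ (des d t ts) = AscFreeⁱ t × AscFreeᵐ ts
  AscFreeⁱ (t ∷∷ T)     = ⊥

  AscFreeᵐ : MSubC S γ ξ → Set
  AscFreeᵐ ε        = ⊤
  AscFreeᵐ (ts ▸ t) = AscFreeᵐ ts × AscFreeᶜ t

module Judgments {S : Sig} (𝕋 : Theory S) where

  infix 4 _⟶_ _⟶ˢ_ _⟶ᵐ_ _⟶*_ _≃_ _≃ᵐ_

  mutual
    data _⟶_ {θ : MScope} {γ : Scope} : Tm S θ γ → Tm S θ γ → Set where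
      step : ∀ {R} → R ∈ rewrites 𝕋 → (v : MSub S θ γ (scope R)) →
             lhs R [ v ] ⟶ rhs R [ v ]
      mvar : ∀ {x : δ ∈ θ} {ts us} → ts ⟶ˢ us → mvar x ts ⟶ mvar x us
      con  : ∀ {c : con ξ ∈ S} {ts us} → ts ⟶ᵐ us → con c ts ⟶ con c us
      des₁ : ∀ {d : des ξ ∈ S} {t u ts} → t ⟶ u → des d t ts ⟶ des d u ts
      des₂ : ∀ {d : des ξ ∈ S} {t ts us} → ts ⟶ᵐ us → des d t ts ⟶ des d t us

    data _⟶ˢ_ {θ : MScope} {γ : Scope} : Sub S θ γ δ → Sub S θ γ δ → Set where
      left  : ∀ {ts us : Sub S θ γ δ} {t} → ts ⟶ˢ us → (ts ▸ t) ⟶ˢ (us ▸ t)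
      right : ∀ {ts : Sub S θ γ δ} {t u} → t ⟶ u → (ts ▸ t) ⟶ˢ (ts ▸ u)

    data _⟶ᵐ_ {θ : MScope} {γ : Scope} : MSub S θ γ ξ → MSub S θ γ ξ → Set where
      left  : ∀ {ts us : MSub S θ γ ξ} {t : Tm S θ (δ + γ)} →
              ts ⟶ᵐ us → (ts ▸ t) ⟶ᵐ (us ▸ t)
      right : ∀ {ts : MSub S θ γ ξ} {t u : Tm S θ (δ + γ)} →
              t ⟶ u → (ts ▸ t) ⟶ᵐ (ts ▸ u)

  _⟶*_ : Tm S θ γ → Tm S θ γ → Set
  _⟶*_ = Star _⟶_

  _≃_ : Tm S θ γ → Tm S θ γ → Set
  _≃_ = EqClosure _⟶_

  _≃ᵐ_ : MSub S θ γ ξ → MSub S θ γ ξ → Set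
  _≃ᵐ_ = EqClosure _⟶ᵐ_

  infix 3 ⊢_ _⊢ctx_ _∣_⊢_sort _∣_⊢_∶_ _∣_⊢ˢ_∶_ _∣_⊢ᵐ_∶_

  mutual
    data ⊢_ : MCtx S θ → Set where
      ε   : ⊢ ε
      ext : ∀ {Θ : MCtx S θ} {Γ : Ctx S θ 0 γ} {T} →
            Θ ∣ Γ ⊢ T sort → ⊢ (Θ ▸ Γ ∶ T)

    data _⊢ctx_ (Θ : MCtx S θ) : Ctx S θ 0 γ → Set where
      ε   : ⊢ Θ → Θ ⊢ctx ε
      ext : ∀ {Γ : Ctx S θ 0 γ} {T} → Θ ∣ Γ ⊢ T sort → Θ ⊢ctx (Γ ▸ T)

    data _∣_⊢_sort (Θ : MCtx S θ) (Γ : Ctx S θ 0 γ) : Tm S θ γ → Set where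
      sort : ∀ {c : con ξ ∈ S} {Ξ ts} →
             declaration 𝕋 c ≡ sort Ξ →
             Θ ∣ Γ ⊢ᵐ ε ⊹ ts ∶ ε ⊹ˣ Ξ →
             Θ ∣ Γ ⊢ con c ts sort

    data _∣_⊢_∶_ (Θ : MCtx S θ) (Γ : Ctx S θ 0 γ) : Tm S θ γ → Tm S θ γ → Set where
      var  : ∀ x → Θ ⊢ctx Γ → Θ ∣ Γ ⊢ var x ∶ lookupVar Γ x

      mvar : ∀ (x : δ ∈ θ) {ts} →
             Θ ∣ Γ ⊢ˢ ts ∶ lookupMCtx Θ x →
             Θ ∣ Γ ⊢ mvar x ts ∶ lookupMTy Θ x [ ts ]ˢ

      cons : ∀ {θp ξc ξi} {c : con ξc ∈ S} {Ξp : MCtx S θp} {Ξc} {vi : MSub S _ _ ξi}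
               {Ξi T tp ts} →
             declaration 𝕋 c ≡ cons Ξp Ξc vi Ξi T →
             Θ ∣ Γ ⊢ᵐ tp ⊹ ts ∶ Ξp ⊹ˣ Ξc →
             Θ ∣ Γ ⊢ ⌊ T ⌋ [ tp ⊹ vi [ tp ⊹ ts ]ᵐ ] sort →
             Θ ∣ Γ ⊢ con c ts ∶ ⌊ T ⌋ [ tp ⊹ vi [ tp ⊹ ts ]ᵐ ]

      dest : ∀ {θpi ξd} {d : des ξd ∈ S} {Ξpi : MCtx S θpi} {T Ξd U tpi t ts} →
             declaration 𝕋 d ≡ dest Ξpi T Ξd U →
             Θ ∣ Γ ⊢ᵐ (tpi ▸ t) ⊹ ts ∶ (Ξpi ▸ ε ∶ ⌊ T ⌋) ⊹ˣ Ξd →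
             Θ ∣ Γ ⊢ des d t ts ∶ U [ (tpi ▸ t) ⊹ ts ]

      conv : ∀ {t T U} →
             Θ ∣ Γ ⊢ t ∶ T → T ≃ U → Θ ∣ Γ ⊢ U sort → Θ ∣ Γ ⊢ t ∶ U

    data _∣_⊢ˢ_∶_ (Θ : MCtx S θ) (Γ : Ctx S θ 0 γ) :
                  Sub S θ γ δ → Ctx S θ 0 δ → Set where
      ε   : Θ ⊢ctx Γ → Θ ∣ Γ ⊢ˢ ε ∶ ε
      ext : ∀ {ts} {t : Tm S θ γ} {Δ : Ctx S θ 0 δ} {T} →
            Θ ∣ Γ ⊢ˢ ts ∶ Δ →
            Θ ∣ Γ ⊢ t ∶ T [ ts ]ˢ →
            Θ ∣ Γ ⊢ˢ ts ▸ t ∶ (Δ ▸ T)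

    data _∣_⊢ᵐ_∶_ (Θ : MCtx S θ) (Γ : Ctx S θ 0 γ) :
                  MSub S θ γ ξ → MCtx S ξ → Set where
      ε   : Θ ⊢ctx Γ → Θ ∣ Γ ⊢ᵐ ε ∶ ε
      ext : ∀ {ts : MSub S θ γ ξ} {Ξ} {Δ : Ctx S ξ 0 δ} {t T} →
            Θ ∣ Γ ⊢ᵐ ts ∶ Ξ →
            Θ ∣ Γ ⊹ᶜ Δ [ ts ]ᶜ ⊢ t ∶ T [ ts ] →
            Θ ∣ Γ ⊢ᵐ ts ▸ t ∶ (Ξ ▸ Δ ∶ T)

  -- A pattern over γ is matched against a term over δ.γ.

  infix 4 _≺_⇝_ _≺ᵐ_⇝_

  mutual
    data _≺_⇝_ {δ : Scope} : TmP S θ γ → Tm S [] (γ + δ) → MSub S [] δ θ → Set where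
      con  : ∀ {c : con ξ ∈ S} {ts : MSubP S θ γ ξ} {u us v} →
             u ⟶* con c us → ts ≺ᵐ us ⇝ v → con c ts ≺ u ⇝ v
      mvar : ∀ {u : Tm S [] (γ + δ)} → mvar ≺ u ⇝ (ε ▸ u)

    data _≺ᵐ_⇝_ {δ : Scope} :
                MSubP S θ γ ξ → MSub S [] (γ + δ) ξ → MSub S [] δ θ → Set where
      ε   : ε {γ = γ} ≺ᵐ ε ⇝ ε
      -- u is over (δ.γ).δ′, and has to be seen over δ.(γ.δ′).
      ext : ∀ {ts : MSubP S θ₁ γ ξ} {us v₁} {t : TmP S θ₂ (δ′ + γ)} {u v₂} →
            ts ≺ᵐ us ⇝ v₁ →
            t ≺ ren (cast (sym (+-assoc δ′ γ δ))) u ⇝ v₂ →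
            (ts ▸ t) ≺ᵐ (us ▸ u) ⇝ (v₁ ⊹ v₂)

  infix 3 _⊢_⇐sort _⊢_⇐_ _⊢_⇒_ _∣_∶_⊢_⇐_

  mutual
    data _⊢_⇐sort (Γ : Ctx S [] 0 γ) : TmC S γ → Set where
      sort : ∀ {c : con ξ ∈ S} {Ξ ts} →
             declaration 𝕋 c ≡ sort Ξ →
             Γ ∣ ε ∶ ε ⊢ ts ⇐ Ξ →
             Γ ⊢ con c ts ⇐sort

    data _⊢_⇐_ (Γ : Ctx S [] 0 γ) : TmC S γ → Tm S [] γ → Set where
      cons : ∀ {θp ξc ξi} {c : con ξc ∈ S} {Ξp : MCtx S θp} {Ξc} {vi : MSub S _ _ ξi}
               {Ξi T us T′ tp ti} →
             declaration 𝕋 c ≡ cons Ξp Ξc vi Ξi T →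
             T ≺ T′ ⇝ (tp ⊹ ti) →
             Γ ∣ tp ∶ Ξp ⊢ us ⇐ Ξc →
             ti ≃ᵐ vi [ tp ⊹ ⌜ us ⌝ᵐ ]ᵐ →
             Γ ⊢ con c us ⇐ T′

      switch : ∀ {t T U} → Γ ⊢ t ⇒ T → T ≃ U → Γ ⊢ underline t ⇐ U

    data _⊢_⇒_ (Γ : Ctx S [] 0 γ) : TmI S γ → Tm S [] γ → Set where
      var   : ∀ x → Γ ⊢ var x ⇒ lookupVar Γ x

      annot : ∀ {t T} → Γ ⊢ T ⇐sort → Γ ⊢ t ⇐ ⌜ T ⌝ᶜ → Γ ⊢ t ∷∷ T ⇒ ⌜ T ⌝ᶜ

      dest  : ∀ {θpi ξd} {d : des ξd ∈ S} {Ξpi : MCtx S θpi} {T Ξd U t T′ ts us} →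
              declaration 𝕋 d ≡ dest Ξpi T Ξd U →
              Γ ⊢ t ⇒ T′ →
              T ≺ T′ ⇝ ts →
              Γ ∣ ts ▸ ⌜ t ⌝ⁱ ∶ (Ξpi ▸ ε ∶ ⌊ T ⌋) ⊢ us ⇐ Ξd →
              Γ ⊢ des d t us ⇒ U [ (ts ▸ ⌜ t ⌝ⁱ) ⊹ ⌜ us ⌝ᵐ ]

    data _∣_∶_⊢_⇐_ (Γ : Ctx S [] 0 γ) (v : MSub S [] γ θ) (Θ : MCtx S θ) :
                   MSubC S γ ξ → MTel S θ ξ → Set where
      ε   : Γ ∣ v ∶ Θ ⊢ ε ⇐ ε
      ext : ∀ {ts : MSubC S γ ξ} {Ξ} {Δ : Ctx S (ξ ++ θ) 0 δ} {t T} →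
            Γ ∣ v ∶ Θ ⊢ ts ⇐ Ξ →
            Γ ⊹ᶜ Δ [ v ⊹ ⌜ ts ⌝ᵐ ]ᶜ ⊢ t ⇐ T [ v ⊹ ⌜ ts ⌝ᵐ ] →
            Γ ∣ v ∶ Θ ⊢ ts ▸ t ⇐ (Ξ ▸ Δ ∶ T)

{-# OPTIONS --safe #-}
-- Completeness needs no metatheory of typing once it is strengthened up to
-- conversion: a declarative derivation in Γ at type T yields a bidirectional
-- one in any Γ′ ≃ Γ at any T′ ≃ T.  The main ingredient is that
-- u ≃ ⌊ p ⌋ [ w ] implies p ≺ u ⇝ v for some v ≃ w.  This follows from
-- confluence, because patterns consist of constructors, which are never
-- contracted.  Rewriting is orthogonal (patterns are linear and contain no
-- destructors below the root, and distinct rules do not overlap), so parallel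
-- reduction has the diamond property.
module Submission where

open import Defs
open import Data.Fin using (Fin; zero; suc; _↑ˡ_; _↑ʳ_; splitAt; cast)
open import Data.Fin.Properties
  using (splitAt-↑ˡ; splitAt-↑ʳ; toℕ-injective; toℕ-↑ˡ; toℕ-↑ʳ; toℕ-cast; cast-involutive)
open import Data.List using ([]; _∷_; _++_)
open import Data.List.Membership.Propositional using (_∈_)
open import Data.List.Membership.Propositional.Properties using (∈-++⁺ˡ; ∈-++⁺ʳ; ∈-map⁻)
open import Data.List.Relation.Unary.Any using (here; there)
open import Data.Nat using (ℕ; zero; suc; _+_; _≤_; _<_; z≤n; s≤s; s≤s⁻¹)
open import Data.Nat.Properties
  using (+-assoc; +-identityʳ; +-mono-≤; ≤-refl; ≤-reflexive; ≤-trans; m≤n⇒m≤1+n; m+n≤o⇒m≤o; m+n≤o⇒n≤o)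
open import Data.Product using (_×_; _,_; proj₁; proj₂; ∃-syntax)
open import Data.Sum using (_⊎_; inj₁; inj₂; [_,_]′)
open import Function using (_∘_; id)
open import Relation.Binary.Construct.Closure.Equivalence
  using (symmetric; isEquivalence; gmap; gfold)
open import Relation.Binary.Construct.Closure.ReflexiveTransitive as Star using (Star; ε; _◅_; _◅◅_)
open import Relation.Binary.Construct.Closure.Symmetric using (fwd; bwd)
open import Relation.Nullary using (¬_; contradiction)
open import Relation.Binary.PropositionalEquality
  using (_≡_; refl; sym; trans; cong; cong₂; subst; subst₂; module ≡-Reasoning)

-- Renaming and substitution

-- Reduction and conversion live on raw terms, so confluence requires no typing. Apart from matching
-- and conversion, the bidirectional rules ask only for premises that a declarative derivation
-- already contains. Ascription-freeness matters because erasure forgets the ascribed type, about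
-- which the declarative derivation then says nothing. The technical obstacle is that `⌊ p ⌋ [ v ]`
-- is computed by lookup and substitution and cannot be inverted directly. It is replaced by
-- `inst p v`, recursive on the pattern, so that injectivity, stability under reduction, the size
-- bound and matching become inductions on `p`. The price is the bookkeeping of reassociated scopes
-- under binders.

liftRen-↑ˡ : ∀ δ (ρ : Ren γ γ′) i → liftRen δ ρ (i ↑ˡ γ) ≡ i ↑ˡ γ′
liftRen-↑ˡ {γ} δ ρ i rewrite splitAt-↑ˡ δ i γ = refl

liftRen-↑ʳ : ∀ δ (ρ : Ren γ γ′) j → liftRen δ ρ (δ ↑ʳ j) ≡ δ ↑ʳ ρ j
liftRen-↑ʳ {γ} δ ρ j rewrite splitAt-↑ʳ δ γ j = refl

liftSub-↑ˡ : ∀ δ (σ : Fin γ → Tm S θ γ′) i → liftSub δ σ (i ↑ˡ γ) ≡ var (i ↑ˡ γ′)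
liftSub-↑ˡ {γ} δ σ i rewrite splitAt-↑ˡ δ i γ = refl

liftSub-↑ʳ : ∀ δ (σ : Fin γ → Tm S θ γ′) j → liftSub δ σ (δ ↑ʳ j) ≡ ren (δ ↑ʳ_) (σ j)
liftSub-↑ʳ {γ} δ σ j rewrite splitAt-↑ʳ δ γ j = refl

-- Serves where the goal mentions `x` itself, which a `with` on `splitAt δ x` would not refine.
↑-elim : ∀ δ (P : Fin (δ + γ) → Set) →
         (∀ i → P (i ↑ˡ γ)) → (∀ j → P (δ ↑ʳ j)) → ∀ x → P x
↑-elim zero    P l r x       = r x
↑-elim (suc δ) P l r zero    = l zero
↑-elim (suc δ) P l r (suc x) = ↑-elim δ (P ∘ suc) (l ∘ suc) r x

liftRen-id : ∀ δ {ρ : Ren γ γ} → (∀ x → ρ x ≡ x) → ∀ x → liftRen δ ρ x ≡ x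
liftRen-id δ {ρ} h = ↑-elim δ _ (liftRen-↑ˡ δ ρ)
  (λ j → trans (liftRen-↑ʳ δ ρ j) (cong (δ ↑ʳ_) (h j)))

liftRen-∘ : ∀ δ {ρ : Ren γ γ′} {ρ′ : Ren γ′ γ″} {ρ″ : Ren γ γ″} →
            (∀ x → ρ′ (ρ x) ≡ ρ″ x) → ∀ x → liftRen δ ρ′ (liftRen δ ρ x) ≡ liftRen δ ρ″ x
liftRen-∘ δ {ρ} {ρ′} h x with splitAt δ x
... | inj₁ i = liftRen-↑ˡ δ ρ′ i
... | inj₂ j = trans (liftRen-↑ʳ δ ρ′ (ρ j)) (cong (δ ↑ʳ_) (h j))

liftSub-liftRen : ∀ δ {ρ : Ren γ γ′} {σ : Fin γ′ → Tm S θ γ″} {σ″} →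
                  (∀ x → σ (ρ x) ≡ σ″ x) → ∀ x → liftSub δ σ (liftRen δ ρ x) ≡ liftSub δ σ″ x
liftSub-liftRen δ {ρ} {σ} h x with splitAt δ x
... | inj₁ i = liftSub-↑ˡ δ σ i
... | inj₂ j = trans (liftSub-↑ʳ δ σ (ρ j)) (cong (ren (δ ↑ʳ_)) (h j))

liftSub-var : ∀ δ {σ : Fin γ → Tm S θ γ′} {ρ : Ren γ γ′} →
              (∀ x → σ x ≡ var (ρ x)) → ∀ x → liftSub δ σ x ≡ var (liftRen δ ρ x)
liftSub-var δ h x with splitAt δ x
... | inj₁ i = refl
... | inj₂ j = cong (ren (δ ↑ʳ_)) (h j)

mutual
  ren-id : {ρ : Ren γ γ} → (∀ x → ρ x ≡ x) → (t : Tm S θ γ) → ren ρ t ≡ t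
  ren-id h (var x)      = cong var (h x)
  ren-id h (mvar x ts)  = cong (mvar x) (renSub-id h ts)
  ren-id h (con c ts)   = cong (con c) (renMSub-id h ts)
  ren-id h (des d t ts) = cong₂ (des d) (ren-id h t) (renMSub-id h ts)

  renSub-id : {ρ : Ren γ γ} → (∀ x → ρ x ≡ x) → (ts : Sub S θ γ δ) → renSub ρ ts ≡ ts
  renSub-id h ε        = refl
  renSub-id h (ts ▸ t) = cong₂ _▸_ (renSub-id h ts) (ren-id h t)

  renMSub-id : {ρ : Ren γ γ} → (∀ x → ρ x ≡ x) → (ts : MSub S θ γ ξ) → renMSub ρ ts ≡ ts
  renMSub-id h ε                  = refl
  renMSub-id h (_▸_ {δ = δ} ts t) = cong₂ _▸_ (renMSub-id h ts) (ren-id (liftRen-id δ h) t)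

mutual
  ren-∘ : {ρ : Ren γ γ′} {ρ′ : Ren γ′ γ″} {ρ″ : Ren γ γ″} → (∀ x → ρ′ (ρ x) ≡ ρ″ x) →
          (t : Tm S θ γ) → ren ρ′ (ren ρ t) ≡ ren ρ″ t
  ren-∘ h (var x)      = cong var (h x)
  ren-∘ h (mvar x ts)  = cong (mvar x) (renSub-∘ h ts)
  ren-∘ h (con c ts)   = cong (con c) (renMSub-∘ h ts)
  ren-∘ h (des d t ts) = cong₂ (des d) (ren-∘ h t) (renMSub-∘ h ts)

  renSub-∘ : {ρ : Ren γ γ′} {ρ′ : Ren γ′ γ″} {ρ″ : Ren γ γ″} → (∀ x → ρ′ (ρ x) ≡ ρ″ x) →
             (ts : Sub S θ γ δ) → renSub ρ′ (renSub ρ ts) ≡ renSub ρ″ ts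
  renSub-∘ h ε        = refl
  renSub-∘ h (ts ▸ t) = cong₂ _▸_ (renSub-∘ h ts) (ren-∘ h t)

  renMSub-∘ : {ρ : Ren γ γ′} {ρ′ : Ren γ′ γ″} {ρ″ : Ren γ γ″} → (∀ x → ρ′ (ρ x) ≡ ρ″ x) →
              (ts : MSub S θ γ ξ) → renMSub ρ′ (renMSub ρ ts) ≡ renMSub ρ″ ts
  renMSub-∘ h ε                  = refl
  renMSub-∘ h (_▸_ {δ = δ} ts t) = cong₂ _▸_ (renMSub-∘ h ts) (ren-∘ (liftRen-∘ δ h) t)

mutual
  sub-ren : {ρ : Ren γ γ′} {σ : Fin γ′ → Tm S θ γ″} {σ″ : Fin γ → Tm S θ γ″} →
            (∀ x → σ (ρ x) ≡ σ″ x) → (t : Tm S θ γ) → sub σ (ren ρ t) ≡ sub σ″ t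
  sub-ren h (var x)      = h x
  sub-ren h (mvar x ts)  = cong (mvar x) (subSub-ren h ts)
  sub-ren h (con c ts)   = cong (con c) (subMSub-ren h ts)
  sub-ren h (des d t ts) = cong₂ (des d) (sub-ren h t) (subMSub-ren h ts)

  subSub-ren : {ρ : Ren γ γ′} {σ : Fin γ′ → Tm S θ γ″} {σ″ : Fin γ → Tm S θ γ″} →
               (∀ x → σ (ρ x) ≡ σ″ x) → (ts : Sub S θ γ δ) →
               subSub σ (renSub ρ ts) ≡ subSub σ″ ts
  subSub-ren h ε        = refl
  subSub-ren h (ts ▸ t) = cong₂ _▸_ (subSub-ren h ts) (sub-ren h t)

  subMSub-ren : {ρ : Ren γ γ′} {σ : Fin γ′ → Tm S θ γ″} {σ″ : Fin γ → Tm S θ γ″} →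
                (∀ x → σ (ρ x) ≡ σ″ x) → (ts : MSub S θ γ ξ) →
                subMSub σ (renMSub ρ ts) ≡ subMSub σ″ ts
  subMSub-ren h ε                  = refl
  subMSub-ren h (_▸_ {δ = δ} ts t) =
    cong₂ _▸_ (subMSub-ren h ts) (sub-ren (liftSub-liftRen δ h) t)

ren-liftSub : ∀ δ {σ : Fin γ → Tm S θ γ′} {ρ : Ren γ′ γ″} {σ″} →
              (∀ x → ren ρ (σ x) ≡ σ″ x) → ∀ x → ren (liftRen δ ρ) (liftSub δ σ x) ≡ liftSub δ σ″ x
ren-liftSub δ {σ} {ρ} {σ″} h x with splitAt δ x
... | inj₁ i = cong var (liftRen-↑ˡ δ ρ i)
... | inj₂ j = begin
  ren (liftRen δ ρ) (ren (δ ↑ʳ_) (σ j))  ≡⟨ ren-∘ (liftRen-↑ʳ δ ρ) (σ j) ⟩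
  ren ((δ ↑ʳ_) ∘ ρ) (σ j)                ≡⟨ ren-∘ (λ _ → refl) (σ j) ⟨
  ren (δ ↑ʳ_) (ren ρ (σ j))              ≡⟨ cong (ren (δ ↑ʳ_)) (h j) ⟩
  ren (δ ↑ʳ_) (σ″ j)                     ∎
  where open ≡-Reasoning

mutual
  ren-sub : {σ : Fin γ → Tm S θ γ′} {ρ : Ren γ′ γ″} {σ″ : Fin γ → Tm S θ γ″} →
            (∀ x → ren ρ (σ x) ≡ σ″ x) → (t : Tm S θ γ) → ren ρ (sub σ t) ≡ sub σ″ t
  ren-sub h (var x)      = h x
  ren-sub h (mvar x ts)  = cong (mvar x) (renSub-sub h ts)
  ren-sub h (con c ts)   = cong (con c) (renMSub-sub h ts)
  ren-sub h (des d t ts) = cong₂ (des d) (ren-sub h t) (renMSub-sub h ts)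

  renSub-sub : {σ : Fin γ → Tm S θ γ′} {ρ : Ren γ′ γ″} {σ″ : Fin γ → Tm S θ γ″} →
               (∀ x → ren ρ (σ x) ≡ σ″ x) → (ts : Sub S θ γ δ) →
               renSub ρ (subSub σ ts) ≡ subSub σ″ ts
  renSub-sub h ε        = refl
  renSub-sub h (ts ▸ t) = cong₂ _▸_ (renSub-sub h ts) (ren-sub h t)

  renMSub-sub : {σ : Fin γ → Tm S θ γ′} {ρ : Ren γ′ γ″} {σ″ : Fin γ → Tm S θ γ″} →
                (∀ x → ren ρ (σ x) ≡ σ″ x) → (ts : MSub S θ γ ξ) →
                renMSub ρ (subMSub σ ts) ≡ subMSub σ″ ts
  renMSub-sub h ε                  = refl
  renMSub-sub h (_▸_ {δ = δ} ts t) =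
    cong₂ _▸_ (renMSub-sub h ts) (ren-sub (ren-liftSub δ h) t)

sub-liftSub : ∀ δ {σ : Fin γ → Tm S θ γ′} {σ′ : Fin γ′ → Tm S θ γ″} {σ″} →
              (∀ x → sub σ′ (σ x) ≡ σ″ x) →
              ∀ x → sub (liftSub δ σ′) (liftSub δ σ x) ≡ liftSub δ σ″ x
sub-liftSub δ {σ} {σ′} {σ″} h x with splitAt δ x
... | inj₁ i = liftSub-↑ˡ δ σ′ i
... | inj₂ j = begin
  sub (liftSub δ σ′) (ren (δ ↑ʳ_) (σ j))  ≡⟨ sub-ren (liftSub-↑ʳ δ σ′) (σ j) ⟩
  sub (ren (δ ↑ʳ_) ∘ σ′) (σ j)            ≡⟨ ren-sub (λ _ → refl) (σ j) ⟨
  ren (δ ↑ʳ_) (sub σ′ (σ j))              ≡⟨ cong (ren (δ ↑ʳ_)) (h j) ⟩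
  ren (δ ↑ʳ_) (σ″ j)                      ∎
  where open ≡-Reasoning

mutual
  sub-∘ : {σ : Fin γ → Tm S θ γ′} {σ′ : Fin γ′ → Tm S θ γ″} {σ″ : Fin γ → Tm S θ γ″} →
          (∀ x → sub σ′ (σ x) ≡ σ″ x) → (t : Tm S θ γ) → sub σ′ (sub σ t) ≡ sub σ″ t
  sub-∘ h (var x)      = h x
  sub-∘ h (mvar x ts)  = cong (mvar x) (subSub-∘ h ts)
  sub-∘ h (con c ts)   = cong (con c) (subMSub-∘ h ts)
  sub-∘ h (des d t ts) = cong₂ (des d) (sub-∘ h t) (subMSub-∘ h ts)

  subSub-∘ : {σ : Fin γ → Tm S θ γ′} {σ′ : Fin γ′ → Tm S θ γ″} {σ″ : Fin γ → Tm S θ γ″} →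
             (∀ x → sub σ′ (σ x) ≡ σ″ x) → (ts : Sub S θ γ δ) →
             subSub σ′ (subSub σ ts) ≡ subSub σ″ ts
  subSub-∘ h ε        = refl
  subSub-∘ h (ts ▸ t) = cong₂ _▸_ (subSub-∘ h ts) (sub-∘ h t)

  subMSub-∘ : {σ : Fin γ → Tm S θ γ′} {σ′ : Fin γ′ → Tm S θ γ″} {σ″ : Fin γ → Tm S θ γ″} →
              (∀ x → sub σ′ (σ x) ≡ σ″ x) → (ts : MSub S θ γ ξ) →
              subMSub σ′ (subMSub σ ts) ≡ subMSub σ″ ts
  subMSub-∘ h ε                  = refl
  subMSub-∘ h (_▸_ {δ = δ} ts t) =
    cong₂ _▸_ (subMSub-∘ h ts) (sub-∘ (sub-liftSub δ h) t)

mutual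
  sub-var : {σ : Fin γ → Tm S θ γ′} {ρ : Ren γ γ′} → (∀ x → σ x ≡ var (ρ x)) →
            (t : Tm S θ γ) → sub σ t ≡ ren ρ t
  sub-var h (var x)      = h x
  sub-var h (mvar x ts)  = cong (mvar x) (subSub-var h ts)
  sub-var h (con c ts)   = cong (con c) (subMSub-var h ts)
  sub-var h (des d t ts) = cong₂ (des d) (sub-var h t) (subMSub-var h ts)

  subSub-var : {σ : Fin γ → Tm S θ γ′} {ρ : Ren γ γ′} → (∀ x → σ x ≡ var (ρ x)) →
               (ts : Sub S θ γ δ) → subSub σ ts ≡ renSub ρ ts
  subSub-var h ε        = refl
  subSub-var h (ts ▸ t) = cong₂ _▸_ (subSub-var h ts) (sub-var h t)

  subMSub-var : {σ : Fin γ → Tm S θ γ′} {ρ : Ren γ γ′} → (∀ x → σ x ≡ var (ρ x)) →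
                (ts : MSub S θ γ ξ) → subMSub σ ts ≡ renMSub ρ ts
  subMSub-var h ε                  = refl
  subMSub-var h (_▸_ {δ = δ} ts t) = cong₂ _▸_ (subMSub-var h ts) (sub-var (liftSub-var δ h) t)

lookup-subSub : (σ : Fin γ → Tm S θ γ′) (ts : Sub S θ γ δ) (x : Fin δ) →
                lookupSub (subSub σ ts) x ≡ sub σ (lookupSub ts x)
lookup-subSub σ (ts ▸ t) zero    = refl
lookup-subSub σ (ts ▸ t) (suc x) = lookup-subSub σ ts x

lookup-subMSub : (σ : Fin γ → Tm S θ γ′) (ts : MSub S θ γ ξ) (x : δ ∈ ξ) →
                 lookupMSub (subMSub σ ts) x ≡ sub (liftSub δ σ) (lookupMSub ts x)
lookup-subMSub σ (ts ▸ t) (here refl) = refl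
lookup-subMSub σ (ts ▸ t) (there x)   = lookup-subMSub σ ts x

mutual
  -- The two hypotheses fix `σ′` on the two embedded scopes: on the image of `ρ` it acts as `σ`, on
  -- the image of `τ` as a renaming. With arbitrary embeddings the claim is stable under binders,
  -- which the special case `_[_]` is not.
  sub-msub : {σ : Fin δ → Tm S θ′ δ′} {σ′ : Fin γ′ → Tm S θ′ γ″} {v : MSub S θ′ δ θ}
             {ρ : Ren δ γ′} {τ : Ren γ γ′} {ρ′ : Ren δ′ γ″} {τ′ : Ren γ γ″} →
             (∀ x → σ′ (ρ x) ≡ ren ρ′ (σ x)) → (∀ x → σ′ (τ x) ≡ var (τ′ x)) →
             (t : Tm S θ γ) → sub σ′ (msub v ρ τ t) ≡ msub (subMSub σ v) ρ′ τ′ t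
  sub-msub hρ hτ (var x) = hτ x
  sub-msub {σ = σ} {σ′} {v} {ρ} {τ} {ρ′} {τ′} hρ hτ (mvar {δ = β} x ts) = begin
    sub σ′ (sub f (lookupMSub v x))            ≡⟨ sub-∘ (λ _ → refl) (lookupMSub v x) ⟩
    sub (sub σ′ ∘ f) (lookupMSub v x)          ≡⟨ sub-∘ g∘lift (lookupMSub v x) ⟨
    sub g (sub (liftSub β σ) (lookupMSub v x)) ≡⟨ cong (sub g) (lookup-subMSub σ v x) ⟨
    sub g (lookupMSub (subMSub σ v) x)         ∎
    where
    open ≡-Reasoning
    f = [ lookupSub (msubSub v ρ τ ts) , var ∘ ρ ]′ ∘ splitAt β
    g = [ lookupSub (msubSub (subMSub σ v) ρ′ τ′ ts) , var ∘ ρ′ ]′ ∘ splitAt β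
    g-↑ˡ : ∀ i → g (i ↑ˡ _) ≡ lookupSub (msubSub (subMSub σ v) ρ′ τ′ ts) i
    g-↑ˡ i = cong [ _ , _ ]′ (splitAt-↑ˡ β i _)
    g-↑ʳ : ∀ j → g (β ↑ʳ j) ≡ var (ρ′ j)
    g-↑ʳ j = cong [ _ , _ ]′ (splitAt-↑ʳ β _ j)
    -- A variable bound by the entry stands for one of the arguments `ts`, settled by recursion; a
    -- variable of the outer scope is settled by `hρ`.
    g∘lift : ∀ y → sub g (liftSub β σ y) ≡ sub σ′ (f y)
    g∘lift y with splitAt β y
    ... | inj₁ i = begin
      g (i ↑ˡ _)                                       ≡⟨ g-↑ˡ i ⟩
      lookupSub (msubSub (subMSub σ v) ρ′ τ′ ts) i     ≡⟨ cong (λ us → lookupSub us i) (subSub-msub hρ hτ ts) ⟨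
      lookupSub (subSub σ′ (msubSub v ρ τ ts)) i       ≡⟨ lookup-subSub σ′ (msubSub v ρ τ ts) i ⟩
      sub σ′ (lookupSub (msubSub v ρ τ ts) i)          ∎
    ... | inj₂ j = begin
      sub g (ren (β ↑ʳ_) (σ j))  ≡⟨ sub-ren g-↑ʳ (σ j) ⟩
      sub (var ∘ ρ′) (σ j)       ≡⟨ sub-var (λ _ → refl) (σ j) ⟩
      ren ρ′ (σ j)               ≡⟨ hρ j ⟨
      σ′ (ρ j)                   ∎
  sub-msub hρ hτ (con c ts)   = cong (con c) (subMSub-msub hρ hτ ts)
  sub-msub hρ hτ (des d t ts) = cong₂ (des d) (sub-msub hρ hτ t) (subMSub-msub hρ hτ ts)

  subSub-msub : {σ : Fin δ → Tm S θ′ δ′} {σ′ : Fin γ′ → Tm S θ′ γ″} {v : MSub S θ′ δ θ}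
                {ρ : Ren δ γ′} {τ : Ren γ γ′} {ρ′ : Ren δ′ γ″} {τ′ : Ren γ γ″} →
                (∀ x → σ′ (ρ x) ≡ ren ρ′ (σ x)) → (∀ x → σ′ (τ x) ≡ var (τ′ x)) →
                ∀ {β} (ts : Sub S θ γ β) →
                subSub σ′ (msubSub v ρ τ ts) ≡ msubSub (subMSub σ v) ρ′ τ′ ts
  subSub-msub hρ hτ ε        = refl
  subSub-msub hρ hτ (ts ▸ t) = cong₂ _▸_ (subSub-msub hρ hτ ts) (sub-msub hρ hτ t)

  subMSub-msub : {σ : Fin δ → Tm S θ′ δ′} {σ′ : Fin γ′ → Tm S θ′ γ″} {v : MSub S θ′ δ θ}
                 {ρ : Ren δ γ′} {τ : Ren γ γ′} {ρ′ : Ren δ′ γ″} {τ′ : Ren γ γ″} →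
                 (∀ x → σ′ (ρ x) ≡ ren ρ′ (σ x)) → (∀ x → σ′ (τ x) ≡ var (τ′ x)) →
                 (ts : MSub S θ γ ξ) →
                 subMSub σ′ (msubMSub v ρ τ ts) ≡ msubMSub (subMSub σ v) ρ′ τ′ ts
  subMSub-msub hρ hτ ε = refl
  subMSub-msub {σ = σ} {σ′} {ρ = ρ} {τ} {ρ′} {τ′} hρ hτ (_▸_ {δ = β} ts t) =
    cong₂ _▸_ (subMSub-msub hρ hτ ts) (sub-msub hρ↑ hτ↑ t)
    where
    open ≡-Reasoning
    hρ↑ : ∀ x → liftSub β σ′ (β ↑ʳ ρ x) ≡ ren ((β ↑ʳ_) ∘ ρ′) (σ x)
    hρ↑ x = begin
      liftSub β σ′ (β ↑ʳ ρ x)         ≡⟨ liftSub-↑ʳ β σ′ (ρ x) ⟩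
      ren (β ↑ʳ_) (σ′ (ρ x))          ≡⟨ cong (ren (β ↑ʳ_)) (hρ x) ⟩
      ren (β ↑ʳ_) (ren ρ′ (σ x))      ≡⟨ ren-∘ (λ _ → refl) (σ x) ⟩
      ren ((β ↑ʳ_) ∘ ρ′) (σ x)        ∎
    hτ↑ : ∀ x → liftSub β σ′ (liftRen β τ x) ≡ var (liftRen β τ′ x)
    hτ↑ x = trans (liftSub-liftRen β hτ x) (liftSub-var β (λ _ → refl) x)

-- Since `t` has no variables of its own, the condition on `τ` is vacuous. Both sides of a rewrite
-- rule are of this kind, which makes reduction stable under substitution.
sub-[] : (σ : Fin γ → Tm S θ′ γ′) (v : MSub S θ′ γ θ) (t : Tm S θ 0) →
         sub σ (t [ v ]) ≡ t [ subMSub σ v ]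
sub-[] σ v t = sub-msub (λ x → sym (ren-id (λ _ → refl) (σ x))) (λ ()) t

ren-[] : (ρ : Ren γ γ′) (v : MSub S θ′ γ θ) (t : Tm S θ 0) →
         ren ρ (t [ v ]) ≡ t [ renMSub ρ v ]
ren-[] ρ v t = begin
  ren ρ (t [ v ])          ≡⟨ sub-var (λ _ → refl) (t [ v ]) ⟨
  sub (var ∘ ρ) (t [ v ])  ≡⟨ sub-[] (var ∘ ρ) v t ⟩
  t [ subMSub (var ∘ ρ) v ]  ≡⟨ cong (t [_]) (subMSub-var (λ _ → refl) v) ⟩
  t [ renMSub ρ v ]        ∎
  where open ≡-Reasoning

-- Instances of linear patterns

outer : ∀ θ₂ → MSub S θ δ (θ₂ ++ θ₁) → MSub S θ δ θ₁
outer []       v       = v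
outer (_ ∷ θ₂) (v ▸ t) = outer θ₂ v

inner : ∀ θ₂ → MSub S θ δ (θ₂ ++ θ₁) → MSub S θ δ θ₂
inner []       v       = ε
inner (_ ∷ θ₂) (v ▸ t) = inner θ₂ v ▸ t

outer⊹inner : ∀ θ₂ (v : MSub S θ δ (θ₂ ++ θ₁)) → outer θ₂ v ⊹ inner θ₂ v ≡ v
outer⊹inner []       v       = refl
outer⊹inner (_ ∷ θ₂) (v ▸ t) = cong (_▸ t) (outer⊹inner θ₂ v)

outer-⊹ : (v : MSub S θ δ θ₁) (w : MSub S θ δ θ₂) → outer θ₂ (v ⊹ w) ≡ v
outer-⊹ v ε       = refl
outer-⊹ v (w ▸ t) = outer-⊹ v w

inner-⊹ : (v : MSub S θ δ θ₁) (w : MSub S θ δ θ₂) → inner θ₂ (v ⊹ w) ≡ w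
inner-⊹ v ε       = refl
inner-⊹ v (w ▸ t) = cong (_▸ t) (inner-⊹ v w)

lookup-outer : ∀ θ₂ (v : MSub S θ δ (θ₂ ++ θ₁)) (x : δ′ ∈ θ₁) →
               lookupMSub v (∈-++⁺ʳ θ₂ x) ≡ lookupMSub (outer θ₂ v) x
lookup-outer []       v       x = refl
lookup-outer (_ ∷ θ₂) (v ▸ t) x = lookup-outer θ₂ v x

lookup-inner : ∀ θ₂ (v : MSub S θ δ (θ₂ ++ θ₁)) (x : δ′ ∈ θ₂) →
               lookupMSub v (∈-++⁺ˡ x) ≡ lookupMSub (inner θ₂ v) x
lookup-inner (_ ∷ θ₂) (v ▸ t) (here refl) = refl
lookup-inner (_ ∷ θ₂) (v ▸ t) (there x)   = lookup-inner θ₂ v x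

mutual
  -- `⌊_⌋ᵐ` embeds the metavariables of each component into a joint scope by `mren`; here that
  -- embedding is traded for restricting `v` to the component's share.
  msub-mren : {v : MSub S θ δ θ₁} {w : MSub S θ δ θ₂} {φ : MRen θ₂ θ₁} →
              (∀ {β} (x : β ∈ θ₂) → lookupMSub v (φ x) ≡ lookupMSub w x) →
              {ρ : Ren δ γ′} {τ : Ren γ γ′} (t : Tm S θ₂ γ) →
              msub v ρ τ (mren φ t) ≡ msub w ρ τ t
  msub-mren h (var x)               = refl
  msub-mren h {ρ} (mvar {δ = β} x ts) =
    cong₂ (λ us → sub ([ lookupSub us , var ∘ ρ ]′ ∘ splitAt β)) (msubSub-mren h ts) (h x)
  msub-mren h (con c ts)            = cong (con c) (msubMSub-mren h ts)
  msub-mren h (des d t ts)          = cong₂ (des d) (msub-mren h t) (msubMSub-mren h ts)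

  msubSub-mren : {v : MSub S θ δ θ₁} {w : MSub S θ δ θ₂} {φ : MRen θ₂ θ₁} →
                 (∀ {β} (x : β ∈ θ₂) → lookupMSub v (φ x) ≡ lookupMSub w x) →
                 {ρ : Ren δ γ′} {τ : Ren γ γ′} (ts : Sub S θ₂ γ δ′) →
                 msubSub v ρ τ (mrenSub φ ts) ≡ msubSub w ρ τ ts
  msubSub-mren h ε        = refl
  msubSub-mren h (ts ▸ t) = cong₂ _▸_ (msubSub-mren h ts) (msub-mren h t)

  msubMSub-mren : {v : MSub S θ δ θ₁} {w : MSub S θ δ θ₂} {φ : MRen θ₂ θ₁} →
                  (∀ {β} (x : β ∈ θ₂) → lookupMSub v (φ x) ≡ lookupMSub w x) →
                  {ρ : Ren δ γ′} {τ : Ren γ γ′} (ts : MSub S θ₂ γ ξ) →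
                  msubMSub v ρ τ (mrenMSub φ ts) ≡ msubMSub w ρ τ ts
  msubMSub-mren h ε        = refl
  msubMSub-mren h (ts ▸ t) = cong₂ _▸_ (msubMSub-mren h ts) (msub-mren h t)

lookup-msub-tabulate : (v : MSub S θ′ δ θ) (ρ : Ren δ γ′) (τ : Ren γ γ′)
                       (f : Fin δ′ → Tm S θ γ) (x : Fin δ′) →
                       lookupSub (msubSub v ρ τ (tabulateSub f)) x ≡ msub v ρ τ (f x)
lookup-msub-tabulate v ρ τ f zero    = refl
lookup-msub-tabulate v ρ τ f (suc x) = lookup-msub-tabulate v ρ τ (f ∘ suc) x

-- Below a binder an instance lives over the pattern's extended scope followed by the outer one,
-- while the enclosing list expects the other bracketing. The inverse `assocˡ` is the cast in the
-- rule `ext` of matching.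
assocʳ : ∀ δ γ δ′ → Fin (δ + γ + δ′) → Fin (δ + (γ + δ′))
assocʳ δ γ δ′ = cast (+-assoc δ γ δ′)

assocˡ : ∀ δ γ δ′ → Fin (δ + (γ + δ′)) → Fin (δ + γ + δ′)
assocˡ δ γ δ′ = cast (sym (+-assoc δ γ δ′))

ren-assocʳ-assocˡ : ∀ δ γ δ′ (t : Tm S θ (δ + (γ + δ′))) →
                    ren (assocʳ δ γ δ′) (ren (assocˡ δ γ δ′) t) ≡ t
ren-assocʳ-assocˡ δ γ δ′ t = trans (ren-∘ (λ _ → refl) t)
  (ren-id (cast-involutive (+-assoc δ γ δ′) (sym (+-assoc δ γ δ′))) t)

ren-assocˡ-assocʳ : ∀ δ γ δ′ (t : Tm S θ (δ + γ + δ′)) →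
                    ren (assocˡ δ γ δ′) (ren (assocʳ δ γ δ′) t) ≡ t
ren-assocˡ-assocʳ δ γ δ′ t = trans (ren-∘ (λ _ → refl) t)
  (ren-id (cast-involutive (sym (+-assoc δ γ δ′)) (+-assoc δ γ δ′)) t)

-- The instance ⌊ p ⌋ [ v ] computed by recursion on the pattern: since
-- patterns are linear, v is split rather than looked up.
mutual
  inst : TmP S θ γ → MSub S θ′ δ θ → Tm S θ′ (γ + δ)
  inst mvar       (ε ▸ u) = u
  inst (con c ps) v       = con c (instᵐ ps v)

  instᵐ : MSubP S θ γ ξ → MSub S θ′ δ θ → MSub S θ′ (γ + δ) ξ
  instᵐ ε v = ε
  instᵐ {γ = γ} {δ = δ} (_▸_ {θ₂ = θ₂} {δ = β} ps p) v =
    instᵐ ps (outer θ₂ v) ▸ ren (assocʳ β γ δ) (inst p (inner θ₂ v))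

copair : Ren γ γ′ → Ren δ γ′ → Ren (γ + δ) γ′
copair {γ} τ ρ = [ τ , ρ ]′ ∘ splitAt γ

assocʳ-↑ˡ↑ˡ : ∀ β γ δ (i : Fin β) → assocʳ β γ δ ((i ↑ˡ γ) ↑ˡ δ) ≡ i ↑ˡ (γ + δ)
assocʳ-↑ˡ↑ˡ β γ δ i = toℕ-injective (trans (toℕ-cast _ ((i ↑ˡ γ) ↑ˡ δ))
  (trans (toℕ-↑ˡ (i ↑ˡ γ) δ) (trans (toℕ-↑ˡ i γ) (sym (toℕ-↑ˡ i (γ + δ))))))

assocʳ-↑ʳ↑ˡ : ∀ β γ δ (j : Fin γ) → assocʳ β γ δ ((β ↑ʳ j) ↑ˡ δ) ≡ β ↑ʳ (j ↑ˡ δ)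
assocʳ-↑ʳ↑ˡ β γ δ j = toℕ-injective (trans (toℕ-cast _ ((β ↑ʳ j) ↑ˡ δ))
  (trans (toℕ-↑ˡ (β ↑ʳ j) δ) (trans (toℕ-↑ʳ β j)
    (sym (trans (toℕ-↑ʳ β (j ↑ˡ δ)) (cong (β +_) (toℕ-↑ˡ j δ)))))))

assocʳ-↑ʳ : ∀ β γ δ (k : Fin δ) → assocʳ β γ δ ((β + γ) ↑ʳ k) ≡ β ↑ʳ (γ ↑ʳ k)
assocʳ-↑ʳ β γ δ k = toℕ-injective (trans (toℕ-cast _ ((β + γ) ↑ʳ k))
  (trans (toℕ-↑ʳ (β + γ) k) (trans (+-assoc β γ _)
    (sym (trans (toℕ-↑ʳ β (γ ↑ʳ k)) (cong (β +_) (toℕ-↑ʳ γ k)))))))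

copair-assocʳ : ∀ β (τ : Ren γ γ′) (ρ : Ren δ γ′) (x : Fin (β + γ + δ)) →
                liftRen β (copair τ ρ) (assocʳ β γ δ x) ≡ copair (liftRen β τ) ((β ↑ʳ_) ∘ ρ) x
copair-assocʳ {γ} {γ′} {δ} β τ ρ = ↑-elim (β + γ) _
  (↑-elim β _
    (λ i → trans (cong lift (assocʳ-↑ˡ↑ˡ β γ δ i)) (trans (liftRen-↑ˡ β _ i)
      (sym (trans (cong pair (splitAt-↑ˡ (β + γ) (i ↑ˡ γ) δ)) (liftRen-↑ˡ β τ i)))))
    (λ j → trans (cong lift (assocʳ-↑ʳ↑ˡ β γ δ j)) (trans (liftRen-↑ʳ β _ (j ↑ˡ δ))
      (trans (cong (λ s → β ↑ʳ [ τ , ρ ]′ s) (splitAt-↑ˡ γ j δ))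
        (sym (trans (cong pair (splitAt-↑ˡ (β + γ) (β ↑ʳ j) δ)) (liftRen-↑ʳ β τ j)))))))
  (λ k → trans (cong lift (assocʳ-↑ʳ β γ δ k)) (trans (liftRen-↑ʳ β _ (γ ↑ʳ k))
    (trans (cong (λ s → β ↑ʳ [ τ , ρ ]′ s) (splitAt-↑ʳ γ δ k))
      (sym (cong pair (splitAt-↑ʳ (β + γ) δ k))))))
  where
  lift = liftRen β (copair τ ρ)
  pair : _ → Fin (β + γ′)
  pair = [ liftRen β τ , (β ↑ʳ_) ∘ ρ ]′

mutual
  -- A pattern metavariable is applied to `idSub`, so substituting its arguments merely renames the
  -- entry. Arbitrary `ρ` and `τ` carry the induction under binders.
  msub-pattern : (p : TmP S θ γ) (v : MSub S θ′ δ θ) (ρ : Ren δ γ′) (τ : Ren γ γ′) →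
                 msub v ρ τ ⌊ p ⌋ ≡ ren (copair τ ρ) (inst p v)
  msub-pattern {γ = γ} mvar (ε ▸ u) ρ τ = sub-var h u
    where
    h : ∀ x → [ lookupSub (msubSub (ε ▸ u) ρ τ idSub) , var ∘ ρ ]′ (splitAt γ x) ≡ var (copair τ ρ x)
    h x with splitAt γ x
    ... | inj₁ i = lookup-msub-tabulate (ε ▸ u) ρ τ var i
    ... | inj₂ j = refl
  msub-pattern (con c ps) v ρ τ = cong (con c) (msubMSub-pattern ps v ρ τ)

  msubMSub-pattern : (ps : MSubP S θ γ ξ) (v : MSub S θ′ δ θ) (ρ : Ren δ γ′) (τ : Ren γ γ′) →
                     msubMSub v ρ τ ⌊ ps ⌋ᵐ ≡ renMSub (copair τ ρ) (instᵐ ps v)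
  msubMSub-pattern ε v ρ τ = refl
  msubMSub-pattern (_▸_ {θ₂ = θ₂} {δ = β} ps p) v ρ τ = cong₂ _▸_
    (trans (msubMSub-mren (lookup-outer θ₂ v) ⌊ ps ⌋ᵐ) (msubMSub-pattern ps (outer θ₂ v) ρ τ))
    (begin
      msub v ((β ↑ʳ_) ∘ ρ) (liftRen β τ) (mren ∈-++⁺ˡ ⌊ p ⌋)
        ≡⟨ msub-mren (lookup-inner θ₂ v) ⌊ p ⌋ ⟩
      msub (inner θ₂ v) ((β ↑ʳ_) ∘ ρ) (liftRen β τ) ⌊ p ⌋
        ≡⟨ msub-pattern p (inner θ₂ v) _ _ ⟩
      ren (copair (liftRen β τ) ((β ↑ʳ_) ∘ ρ)) (inst p (inner θ₂ v))
        ≡⟨ ren-∘ (copair-assocʳ β τ ρ) (inst p (inner θ₂ v)) ⟨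
      ren (liftRen β (copair τ ρ)) (ren (assocʳ β _ _) (inst p (inner θ₂ v)))  ∎)
    where open ≡-Reasoning

[]-pattern : (p : TmP S θ 0) (v : MSub S θ′ δ θ) → ⌊ p ⌋ [ v ] ≡ inst p v
[]-pattern p v = trans (msub-pattern p v _ _) (ren-id (λ _ → refl) (inst p v))

-- The instance of the left-hand side in a form whose arguments can be inverted by recursion on the
-- patterns; `lhs-[]` is the bridge to the official form.
redex : (R : Rewrite S) → MSub S θ δ (scope R) → Tm S θ δ
redex (rewr {θts = θts} d p ps r) v = des d (inst p (outer θts v)) (instᵐ ps (inner θts v))

lhs-[] : (R : Rewrite S) (v : MSub S θ δ (scope R)) → lhs R [ v ] ≡ redex R v
lhs-[] (rewr {θts = θts} d p ps r) v = cong₂ (des d)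
  (trans (msub-mren (lookup-outer θts v) ⌊ p ⌋) ([]-pattern p (outer θts v)))
  (trans (msubMSub-mren (lookup-inner θts v) ⌊ ps ⌋ᵐ)
    (trans (msubMSub-pattern ps (inner θts v) _ _)
      (renMSub-id (λ _ → refl) (instᵐ ps (inner θts v)))))

-- Injectivity of instances and uniqueness of the contracted rule

con-injective : {c : con ξ ∈ S} {ts us : MSub S θ γ ξ} →
                Tm.con {θ = θ} {γ = γ} c ts ≡ con c us → ts ≡ us
con-injective refl = refl

▸-injective : {ts us : MSub S θ γ ξ} {t u : Tm S θ (δ + γ)} →
              MSub._▸_ {δ = δ} ts t ≡ us ▸ u → ts ≡ us × t ≡ u
▸-injective refl = refl , refl

mutual
  -- Every metavariable of the scope occurs in the pattern, applied to all variables bound there, so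
  -- each entry can be read off the instance.
  inst-injective : (p : TmP S θ γ) (v w : MSub S θ′ δ θ) → inst p v ≡ inst p w → v ≡ w
  inst-injective mvar       (ε ▸ u) (ε ▸ u′) h = cong (ε ▸_) h
  inst-injective (con c ps) v       w        h = instᵐ-injective ps v w (con-injective h)

  instᵐ-injective : (ps : MSubP S θ γ ξ) (v w : MSub S θ′ δ θ) → instᵐ ps v ≡ instᵐ ps w → v ≡ w
  instᵐ-injective ε ε ε h = refl
  instᵐ-injective {γ = γ} {δ = δ} (_▸_ {θ₂ = θ₂} {δ = β} ps p) v w h = begin
    v                            ≡⟨ outer⊹inner θ₂ v ⟨
    outer θ₂ v ⊹ inner θ₂ v      ≡⟨ cong₂ _⊹_ (instᵐ-injective ps _ _ (proj₁ (▸-injective h)))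
                                              (inst-injective p _ _ h′) ⟩
    outer θ₂ w ⊹ inner θ₂ w      ≡⟨ outer⊹inner θ₂ w ⟩
    w                            ∎
    where
    open ≡-Reasoning
    h′ : inst p (inner θ₂ v) ≡ inst p (inner θ₂ w)
    h′ = trans (sym (ren-assocˡ-assocʳ β γ δ _))
           (trans (cong (ren (assocˡ β γ δ)) (proj₂ (▸-injective h))) (ren-assocˡ-assocʳ β γ δ _))

des-injective : {d : des ξ ∈ S} {t u : Tm S θ γ} {ts us : MSub S θ γ ξ} →
                Tm.des d t ts ≡ des d u us → t ≡ u × ts ≡ us
des-injective refl = refl , refl

redex-injective : (R : Rewrite S) (v w : MSub S θ δ (scope R)) → redex R v ≡ redex R w → v ≡ w
redex-injective (rewr {θts = θts} d p ps r) v w h = begin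
  v                              ≡⟨ outer⊹inner θts v ⟨
  outer θts v ⊹ inner θts v      ≡⟨ cong₂ _⊹_ (inst-injective p _ _ (proj₁ (des-injective h)))
                                              (instᵐ-injective ps _ _ (proj₂ (des-injective h))) ⟩
  outer θts w ⊹ inner θts w      ≡⟨ outer⊹inner θts w ⟩
  w                              ∎
  where open ≡-Reasoning

-- Collapsing the newest symbol to a fresh metavariable turns an overlap of
-- weakened rules into an overlap over the old signature.
mutual
  collapse : Tm (e ∷ S) θ γ → Tm S (0 ∷ θ) γ
  collapse (var x)               = var x
  collapse (mvar x ts)           = mvar (there x) (collapseSub ts)
  -- The arguments are dropped. Injectivity is irrelevant here: the map only has to preserve
  -- equations and commute with renaming.
  collapse (con (here _) ts)     = mvar (here refl) ε
  collapse (con (there c) ts)    = con c (collapseMSub ts)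
  collapse (des (here _) t ts)   = mvar (here refl) ε
  collapse (des (there d) t ts)  = des d (collapse t) (collapseMSub ts)

  collapseSub : Sub (e ∷ S) θ γ δ → Sub S (0 ∷ θ) γ δ
  collapseSub ε        = ε
  collapseSub (ts ▸ t) = collapseSub ts ▸ collapse t

  collapseMSub : MSub (e ∷ S) θ γ ξ → MSub S (0 ∷ θ) γ ξ
  collapseMSub ε        = ε
  collapseMSub (ts ▸ t) = collapseMSub ts ▸ collapse t

mutual
  collapse-ren : (ρ : Ren γ γ′) (t : Tm (e ∷ S) θ γ) → collapse (ren ρ t) ≡ ren ρ (collapse t)
  collapse-ren ρ (var x)              = refl
  collapse-ren ρ (mvar x ts)          = cong (mvar (there x)) (collapseSub-ren ρ ts)
  collapse-ren ρ (con (here _) ts)    = refl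
  collapse-ren ρ (con (there c) ts)   = cong (con c) (collapseMSub-ren ρ ts)
  collapse-ren ρ (des (here _) t ts)  = refl
  collapse-ren ρ (des (there d) t ts) = cong₂ (des d) (collapse-ren ρ t) (collapseMSub-ren ρ ts)

  collapseSub-ren : (ρ : Ren γ γ′) (ts : Sub (e ∷ S) θ γ δ) →
                    collapseSub (renSub ρ ts) ≡ renSub ρ (collapseSub ts)
  collapseSub-ren ρ ε        = refl
  collapseSub-ren ρ (ts ▸ t) = cong₂ _▸_ (collapseSub-ren ρ ts) (collapse-ren ρ t)

  collapseMSub-ren : (ρ : Ren γ γ′) (ts : MSub (e ∷ S) θ γ ξ) →
                     collapseMSub (renMSub ρ ts) ≡ renMSub ρ (collapseMSub ts)
  collapseMSub-ren ρ ε        = refl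
  collapseMSub-ren ρ (ts ▸ t) = cong₂ _▸_ (collapseMSub-ren ρ ts) (collapse-ren (liftRen _ ρ) t)

collapse-outer : ∀ θ₂ (v : MSub (e ∷ S) θ δ (θ₂ ++ θ₁)) →
                 collapseMSub (outer θ₂ v) ≡ outer θ₂ (collapseMSub v)
collapse-outer []       v       = refl
collapse-outer (_ ∷ θ₂) (v ▸ t) = collapse-outer θ₂ v

collapse-inner : ∀ θ₂ (v : MSub (e ∷ S) θ δ (θ₂ ++ θ₁)) →
                 collapseMSub (inner θ₂ v) ≡ inner θ₂ (collapseMSub v)
collapse-inner []       v       = refl
collapse-inner (_ ∷ θ₂) (v ▸ t) = cong (_▸ collapse t) (collapse-inner θ₂ v)

mutual
  -- A weakened pattern avoids the newest symbol, so only the entries of `v` are collapsed.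
  collapse-inst : (p : TmP S θ γ) (v : MSub (e ∷ S) θ′ δ θ) →
                  collapse (inst (wkTmP p) v) ≡ inst p (collapseMSub v)
  collapse-inst mvar       (ε ▸ u) = refl
  collapse-inst (con c ps) v       = cong (con c) (collapse-instᵐ ps v)

  collapse-instᵐ : (ps : MSubP S θ γ ξ) (v : MSub (e ∷ S) θ′ δ θ) →
                   collapseMSub (instᵐ (wkMSubP ps) v) ≡ instᵐ ps (collapseMSub v)
  collapse-instᵐ ε v = refl
  collapse-instᵐ (_▸_ {θ₂ = θ₂} ps p) v = cong₂ _▸_
    (trans (collapse-instᵐ ps (outer θ₂ v)) (cong (instᵐ ps) (collapse-outer θ₂ v)))
    (trans (collapse-ren _ (inst (wkTmP p) (inner θ₂ v)))
      (cong (ren _) (trans (collapse-inst p (inner θ₂ v)) (cong (inst p) (collapse-inner θ₂ v)))))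

collapse-redex : (R : Rewrite S) (v : MSub (e ∷ S) θ δ (scope R)) →
                 collapse (redex (wkRewrite R) v) ≡ redex R (collapseMSub v)
collapse-redex (rewr {θts = θts} d p ps r) v = cong₂ (des d)
  (trans (collapse-inst p (outer θts v)) (cong (inst p) (collapse-outer θts v)))
  (trans (collapse-instᵐ ps (inner θts v)) (cong (instᵐ ps) (collapse-inner θts v)))

-- Of two different positions in the rule list, the more recent one carries the non-overlap
-- certificate against the other. That certificate speaks of the signature at which the rule was
-- added, whereas instances may use later symbols, so every `declare` is crossed by collapsing.
redex-unique : (𝕋 : Theory S) {R R′ : Rewrite S} → R ∈ rewrites 𝕋 → R′ ∈ rewrites 𝕋 →
               (v : MSub S θ δ (scope R)) (v′ : MSub S θ δ (scope R′)) →
               redex R v ≡ redex R′ v′ → R ≡ R′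
redex-unique (declare 𝕋 D) R∈ R′∈ v v′ eq with ∈-map⁻ wkRewrite R∈ | ∈-map⁻ wkRewrite R′∈
... | R , R∈𝕋 , refl | R′ , R′∈𝕋 , refl =
  cong wkRewrite (redex-unique 𝕋 R∈𝕋 R′∈𝕋 (collapseMSub v) (collapseMSub v′)
    (trans (sym (collapse-redex R v)) (trans (cong collapse eq) (collapse-redex R′ v′))))
redex-unique (rewrite-rule 𝕋 R _) (here refl) (here refl) v v′ eq = refl
redex-unique (rewrite-rule 𝕋 R no) {R′ = R′} (here refl) (there R′∈) v v′ eq =
  contradiction (trans (lhs-[] R v) (trans eq (sym (lhs-[] R′ v′)))) (no R′ R′∈ v v′)
redex-unique (rewrite-rule 𝕋 R no) {R′} (there R′∈) (here refl) v v′ eq =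
  contradiction (trans (lhs-[] R v′) (trans (sym eq) (sym (lhs-[] R′ v)))) (no R′ R′∈ v′ v)
redex-unique (rewrite-rule 𝕋 R _) (there R∈) (there R′∈) v v′ eq = redex-unique 𝕋 R∈ R′∈ v v′ eq

-- Confluence

mutual
  size : Tm S θ γ → ℕ
  size (var x)      = 0
  size (mvar x ts)  = suc (sizeˢ ts)
  size (con c ts)   = suc (sizeᵐ ts)
  size (des d t ts) = suc (size t + sizeᵐ ts)

  sizeˢ : Sub S θ γ δ → ℕ
  sizeˢ ε        = 0
  sizeˢ (ts ▸ t) = sizeˢ ts + size t

  sizeᵐ : MSub S θ γ ξ → ℕ
  sizeᵐ ε        = 0
  sizeᵐ (ts ▸ t) = sizeᵐ ts + size t

mutual
  size-ren : (ρ : Ren γ γ′) (t : Tm S θ γ) → size (ren ρ t) ≡ size t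
  size-ren ρ (var x)      = refl
  size-ren ρ (mvar x ts)  = cong suc (sizeˢ-ren ρ ts)
  size-ren ρ (con c ts)   = cong suc (sizeᵐ-ren ρ ts)
  size-ren ρ (des d t ts) = cong suc (cong₂ _+_ (size-ren ρ t) (sizeᵐ-ren ρ ts))

  sizeˢ-ren : (ρ : Ren γ γ′) (ts : Sub S θ γ δ) → sizeˢ (renSub ρ ts) ≡ sizeˢ ts
  sizeˢ-ren ρ ε        = refl
  sizeˢ-ren ρ (ts ▸ t) = cong₂ _+_ (sizeˢ-ren ρ ts) (size-ren ρ t)

  sizeᵐ-ren : (ρ : Ren γ γ′) (ts : MSub S θ γ ξ) → sizeᵐ (renMSub ρ ts) ≡ sizeᵐ ts
  sizeᵐ-ren ρ ε        = refl
  sizeᵐ-ren ρ (ts ▸ t) = cong₂ _+_ (sizeᵐ-ren ρ ts) (size-ren (liftRen _ ρ) t)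

sizeᵐ-outer-inner : ∀ θ₂ (v : MSub S θ δ (θ₂ ++ θ₁)) →
                    sizeᵐ v ≡ sizeᵐ (outer θ₂ v) + sizeᵐ (inner θ₂ v)
sizeᵐ-outer-inner []       v       = sym (+-identityʳ _)
sizeᵐ-outer-inner (_ ∷ θ₂) (v ▸ t) =
  trans (cong (_+ size t) (sizeᵐ-outer-inner θ₂ v)) (+-assoc (sizeᵐ (outer θ₂ v)) _ _)

mutual
  size-inst : (p : TmP S θ γ) (v : MSub S θ′ δ θ) → sizeᵐ v ≤ size (inst p v)
  size-inst mvar       (ε ▸ u) = ≤-refl
  size-inst (con c ps) v       = m≤n⇒m≤1+n (sizeᵐ-inst ps v)

  sizeᵐ-inst : (ps : MSubP S θ γ ξ) (v : MSub S θ′ δ θ) → sizeᵐ v ≤ sizeᵐ (instᵐ ps v)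
  sizeᵐ-inst ε ε = z≤n
  sizeᵐ-inst (_▸_ {θ₂ = θ₂} ps p) v =
    ≤-trans (≤-reflexive (sizeᵐ-outer-inner θ₂ v))
      (+-mono-≤ (sizeᵐ-inst ps (outer θ₂ v))
        (≤-trans (size-inst p (inner θ₂ v)) (≤-reflexive (sym (size-ren _ (inst p (inner θ₂ v)))))))

-- Each entry occurs in the instance, and the head destructor makes the inequality strict.
size-redex : (R : Rewrite S) (v : MSub S θ δ (scope R)) → sizeᵐ v < size (redex R v)
size-redex (rewr {θts = θts} d p ps r) v rewrite sizeᵐ-outer-inner θts v =
  s≤s (+-mono-≤ (size-inst p (outer θts v)) (sizeᵐ-inst ps (inner θts v)))

-- The detour through `lhs R [ v ]` reuses `sub-[]` and avoids commuting substitution with the casts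
-- inside `inst`.
sub-redex : (σ : Fin γ → Tm S θ′ γ′) (R : Rewrite S) (v : MSub S θ′ γ (scope R)) →
            sub σ (redex R v) ≡ redex R (subMSub σ v)
sub-redex σ R v = trans (cong (sub σ) (sym (lhs-[] R v)))
  (trans (sub-[] σ v (lhs R)) (lhs-[] R (subMSub σ v)))

ren-redex : (ρ : Ren γ γ′) (R : Rewrite S) (v : MSub S θ′ γ (scope R)) →
            ren ρ (redex R v) ≡ redex R (renMSub ρ v)
ren-redex ρ R v = trans (cong (ren ρ) (sym (lhs-[] R v)))
  (trans (ren-[] ρ v (lhs R)) (lhs-[] R (renMSub ρ v)))

module ParallelReduction {S : Sig} (𝕋 : Theory S) where

  infix 4 _⇛_ _⇛ˢ_ _⇛ᵐ_

  mutual
    -- In `step` the redex is given by an equation and not as an index, so that derivations from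
    -- `con` or `des` can be matched without unifying against the function `redex`.
    data _⇛_ {θ : MScope} {γ : Scope} : Tm S θ γ → Tm S θ γ → Set where
      var  : ∀ x → var x ⇛ var x
      mvar : ∀ {x : δ ∈ θ} {ts us} → ts ⇛ˢ us → mvar x ts ⇛ mvar x us
      con  : ∀ {c : con ξ ∈ S} {ts us} → ts ⇛ᵐ us → con c ts ⇛ con c us
      des  : ∀ {d : des ξ ∈ S} {t u ts us} → t ⇛ u → ts ⇛ᵐ us → des d t ts ⇛ des d u us
      step : ∀ {R t v v′} → R ∈ rewrites 𝕋 → t ≡ redex R v → v ⇛ᵐ v′ → t ⇛ rhs R [ v′ ]

    data _⇛ˢ_ {θ : MScope} {γ : Scope} : Sub S θ γ δ → Sub S θ γ δ → Set where
      ε   : ε ⇛ˢ ε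
      _▸_ : ∀ {ts us : Sub S θ γ δ} {t u} → ts ⇛ˢ us → t ⇛ u → ts ▸ t ⇛ˢ us ▸ u

    data _⇛ᵐ_ {θ : MScope} {γ : Scope} : MSub S θ γ ξ → MSub S θ γ ξ → Set where
      ε   : ε ⇛ᵐ ε
      _▸_ : ∀ {ts us : MSub S θ γ ξ} {t u : Tm S θ (δ + γ)} → ts ⇛ᵐ us → t ⇛ u → ts ▸ t ⇛ᵐ us ▸ u

  mutual
    ⇛-refl : (t : Tm S θ γ) → t ⇛ t
    ⇛-refl (var x)      = var x
    ⇛-refl (mvar x ts)  = mvar (⇛ˢ-refl ts)
    ⇛-refl (con c ts)   = con (⇛ᵐ-refl ts)
    ⇛-refl (des d t ts) = des (⇛-refl t) (⇛ᵐ-refl ts)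

    ⇛ˢ-refl : (ts : Sub S θ γ δ) → ts ⇛ˢ ts
    ⇛ˢ-refl ε        = ε
    ⇛ˢ-refl (ts ▸ t) = ⇛ˢ-refl ts ▸ ⇛-refl t

    ⇛ᵐ-refl : (ts : MSub S θ γ ξ) → ts ⇛ᵐ ts
    ⇛ᵐ-refl ε        = ε
    ⇛ᵐ-refl (ts ▸ t) = ⇛ᵐ-refl ts ▸ ⇛-refl t

  mutual
    ⇛-ren : (ρ : Ren γ γ′) {t u : Tm S θ γ} → t ⇛ u → ren ρ t ⇛ ren ρ u
    ⇛-ren ρ (var x)    = var (ρ x)
    ⇛-ren ρ (mvar rs)  = mvar (⇛ˢ-ren ρ rs)
    ⇛-ren ρ (con rs)   = con (⇛ᵐ-ren ρ rs)
    ⇛-ren ρ (des r rs) = des (⇛-ren ρ r) (⇛ᵐ-ren ρ rs)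
    ⇛-ren ρ (step {R} {v = v} {v′} R∈ eq rs) =
      subst (_ ⇛_) (sym (ren-[] ρ v′ (rhs R)))
        (step R∈ (trans (cong (ren ρ) eq) (ren-redex ρ R v)) (⇛ᵐ-ren ρ rs))

    ⇛ˢ-ren : (ρ : Ren γ γ′) {ts us : Sub S θ γ δ} → ts ⇛ˢ us → renSub ρ ts ⇛ˢ renSub ρ us
    ⇛ˢ-ren ρ ε        = ε
    ⇛ˢ-ren ρ (rs ▸ r) = ⇛ˢ-ren ρ rs ▸ ⇛-ren ρ r

    ⇛ᵐ-ren : (ρ : Ren γ γ′) {ts us : MSub S θ γ ξ} → ts ⇛ᵐ us → renMSub ρ ts ⇛ᵐ renMSub ρ us
    ⇛ᵐ-ren ρ ε        = ε
    ⇛ᵐ-ren ρ (rs ▸ r) = ⇛ᵐ-ren ρ rs ▸ ⇛-ren (liftRen _ ρ) r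

  ⇛-liftSub : ∀ δ {σ σ′ : Fin γ → Tm S θ γ′} → (∀ x → σ x ⇛ σ′ x) →
              ∀ x → liftSub δ σ x ⇛ liftSub δ σ′ x
  ⇛-liftSub δ h x with splitAt δ x
  ... | inj₁ i = var _
  ... | inj₂ j = ⇛-ren (δ ↑ʳ_) (h j)

  mutual
    ⇛-sub : {σ σ′ : Fin γ → Tm S θ γ′} → (∀ x → σ x ⇛ σ′ x) →
            {t u : Tm S θ γ} → t ⇛ u → sub σ t ⇛ sub σ′ u
    ⇛-sub h (var x)    = h x
    ⇛-sub h (mvar rs)  = mvar (⇛ˢ-sub h rs)
    ⇛-sub h (con rs)   = con (⇛ᵐ-sub h rs)
    ⇛-sub h (des r rs) = des (⇛-sub h r) (⇛ᵐ-sub h rs)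
    ⇛-sub {σ = σ} {σ′} h (step {R} {v = v} {v′} R∈ eq rs) =
      subst (_ ⇛_) (sym (sub-[] σ′ v′ (rhs R)))
        (step R∈ (trans (cong (sub σ) eq) (sub-redex σ R v)) (⇛ᵐ-sub h rs))

    ⇛ˢ-sub : {σ σ′ : Fin γ → Tm S θ γ′} → (∀ x → σ x ⇛ σ′ x) →
             {ts us : Sub S θ γ δ} → ts ⇛ˢ us → subSub σ ts ⇛ˢ subSub σ′ us
    ⇛ˢ-sub h ε        = ε
    ⇛ˢ-sub h (rs ▸ r) = ⇛ˢ-sub h rs ▸ ⇛-sub h r

    ⇛ᵐ-sub : {σ σ′ : Fin γ → Tm S θ γ′} → (∀ x → σ x ⇛ σ′ x) →
             {ts us : MSub S θ γ ξ} → ts ⇛ᵐ us → subMSub σ ts ⇛ᵐ subMSub σ′ us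
    ⇛ᵐ-sub h ε        = ε
    ⇛ᵐ-sub h (rs ▸ r) = ⇛ᵐ-sub h rs ▸ ⇛-sub (⇛-liftSub _ h) r

  ⇛-lookupSub : {ts us : Sub S θ γ δ} → ts ⇛ˢ us → ∀ x → lookupSub ts x ⇛ lookupSub us x
  ⇛-lookupSub (rs ▸ r) zero    = r
  ⇛-lookupSub (rs ▸ r) (suc x) = ⇛-lookupSub rs x

  ⇛-lookupMSub : {ts us : MSub S θ γ ξ} → ts ⇛ᵐ us → (x : δ ∈ ξ) →
                 lookupMSub ts x ⇛ lookupMSub us x
  ⇛-lookupMSub (rs ▸ r) (here refl) = r
  ⇛-lookupMSub (rs ▸ r) (there x)   = ⇛-lookupMSub rs x

  mutual
    -- At a metavariable both the entry and its arguments may reduce, hence the two-sided form of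
    -- `⇛-sub`. It is applied to right-hand sides, which stay fixed while the substitution reduces.
    ⇛-msub : {v w : MSub S θ′ δ θ} → v ⇛ᵐ w → (ρ : Ren δ γ′) (τ : Ren γ γ′) (t : Tm S θ γ) →
             msub v ρ τ t ⇛ msub w ρ τ t
    ⇛-msub rs ρ τ (var x) = var (τ x)
    ⇛-msub {v = v} {w} rs ρ τ (mvar {δ = β} x ts) = ⇛-sub h (⇛-lookupMSub rs x)
      where
      h : ∀ y → [ lookupSub (msubSub v ρ τ ts) , var ∘ ρ ]′ (splitAt β y) ⇛
                [ lookupSub (msubSub w ρ τ ts) , var ∘ ρ ]′ (splitAt β y)
      h y with splitAt β y
      ... | inj₁ i = ⇛-lookupSub (⇛-msubSub rs ρ τ ts) i
      ... | inj₂ j = var (ρ j)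
    ⇛-msub rs ρ τ (con c ts)   = con (⇛-msubMSub rs ρ τ ts)
    ⇛-msub rs ρ τ (des d t ts) = des (⇛-msub rs ρ τ t) (⇛-msubMSub rs ρ τ ts)

    ⇛-msubSub : {v w : MSub S θ′ δ θ} → v ⇛ᵐ w → (ρ : Ren δ γ′) (τ : Ren γ γ′)
                (ts : Sub S θ γ δ′) → msubSub v ρ τ ts ⇛ˢ msubSub w ρ τ ts
    ⇛-msubSub rs ρ τ ε        = ε
    ⇛-msubSub rs ρ τ (ts ▸ t) = ⇛-msubSub rs ρ τ ts ▸ ⇛-msub rs ρ τ t

    ⇛-msubMSub : {v w : MSub S θ′ δ θ} → v ⇛ᵐ w → (ρ : Ren δ γ′) (τ : Ren γ γ′)
                 (ts : MSub S θ γ ξ) → msubMSub v ρ τ ts ⇛ᵐ msubMSub w ρ τ ts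
    ⇛-msubMSub rs ρ τ ε        = ε
    ⇛-msubMSub rs ρ τ (ts ▸ t) = ⇛-msubMSub rs ρ τ ts ▸ ⇛-msub rs _ _ t

  ⇛ᵐ-⊹ : {v v′ : MSub S θ δ θ₁} {w w′ : MSub S θ δ θ₂} →
         v ⇛ᵐ v′ → w ⇛ᵐ w′ → v ⊹ w ⇛ᵐ v′ ⊹ w′
  ⇛ᵐ-⊹ rs ε         = rs
  ⇛ᵐ-⊹ rs (rs′ ▸ r) = ⇛ᵐ-⊹ rs rs′ ▸ r

  -- Patterns contain no destructors, so reduction never touches them.
  mutual
    inst-⇛ : (p : TmP S θ γ) (v : MSub S θ′ δ θ) {u : Tm S θ′ (γ + δ)} → inst p v ⇛ u →
             ∃[ v′ ] u ≡ inst p v′ × v ⇛ᵐ v′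
    inst-⇛ mvar       (ε ▸ t) r           = ε ▸ _ , refl , ε ▸ r
    inst-⇛ (con c ps) v       (con rs) with instᵐ-⇛ ps v rs
    ... | v′ , refl , rs′ = v′ , refl , rs′

    instᵐ-⇛ : (ps : MSubP S θ γ ξ) (v : MSub S θ′ δ θ) {us : MSub S θ′ (γ + δ) ξ} →
              instᵐ ps v ⇛ᵐ us → ∃[ v′ ] us ≡ instᵐ ps v′ × v ⇛ᵐ v′
    instᵐ-⇛ ε ε ε = ε , refl , ε
    -- The reduction of the last component happens in the reassociated scope; it is carried back
    -- along `assocˡ` to become a reduction of `inst p`.
    instᵐ-⇛ {γ = γ} {δ = δ} (_▸_ {θ₂ = θ₂} {δ = β} ps p) v {us ▸ u} (rs ▸ r)
      with instᵐ-⇛ ps (outer θ₂ v) rs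
         | inst-⇛ p (inner θ₂ v) (subst (_⇛ _) (ren-assocˡ-assocʳ β γ δ _) (⇛-ren (assocˡ β γ δ) r))
    ... | v₁ , refl , rs₁ | v₂ , eq , rs₂ =
      v₁ ⊹ v₂
      , cong₂ _▸_ (cong (instᵐ ps) (sym (outer-⊹ v₁ v₂)))
          (begin
            u                                                ≡⟨ ren-assocʳ-assocˡ β γ δ u ⟨
            ren (assocʳ β γ δ) (ren (assocˡ β γ δ) u)        ≡⟨ cong (ren _) eq ⟩
            ren (assocʳ β γ δ) (inst p v₂)                   ≡⟨ cong (ren _ ∘ inst p) (inner-⊹ v₁ v₂) ⟨
            ren (assocʳ β γ δ) (inst p (inner θ₂ (v₁ ⊹ v₂))) ∎)
      , subst (_⇛ᵐ v₁ ⊹ v₂) (outer⊹inner θ₂ v) (⇛ᵐ-⊹ rs₁ rs₂)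
      where open ≡-Reasoning

  -- Orthogonality at work: reducing the arguments cannot destroy the redex, and by linearity no two
  -- copies of an entry can drift apart.
  redex-⇛ : (R : Rewrite S) (v : MSub S θ δ (scope R)) {d : des ξ ∈ S} {t u : Tm S θ δ}
            {ts us : MSub S θ δ ξ} → des d t ts ≡ redex R v → t ⇛ u → ts ⇛ᵐ us →
            ∃[ v′ ] des d u us ≡ redex R v′ × v ⇛ᵐ v′
  redex-⇛ (rewr {θts = θts} d p ps r) v refl s ss
    with inst-⇛ p (outer θts v) s | instᵐ-⇛ ps (inner θts v) ss
  ... | v₁ , refl , rs₁ | v₂ , refl , rs₂ =
    v₁ ⊹ v₂
    , sym (cong₂ (des d) (cong (inst p) (outer-⊹ v₁ v₂)) (cong (instᵐ ps) (inner-⊹ v₁ v₂)))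
    , subst (_⇛ᵐ v₁ ⊹ v₂) (outer⊹inner θts v) (⇛ᵐ-⊹ rs₁ rs₂)

  -- The bound n on the size makes the recursion well-founded when a
  -- substitution is extracted from a redex.
  mutual
    diamond-≤ : ∀ n {t u u′ : Tm S θ γ} → size t ≤ n → t ⇛ u → t ⇛ u′ →
                ∃[ w ] (u ⇛ w) × (u′ ⇛ w)
    diamond-≤ n _ (var x) (var .x) = _ , var x , var x
    diamond-≤ (suc n) (s≤s b) (mvar rs) (mvar rs′) with diamondˢ-≤ n b rs rs′
    ... | _ , q , q′ = _ , mvar q , mvar q′
    diamond-≤ (suc n) (s≤s b) (con rs) (con rs′) with diamondᵐ-≤ n b rs rs′
    ... | _ , q , q′ = _ , con q , con q′
    diamond-≤ (suc n) {des d t ts} (s≤s b) (des r rs) (des r′ rs′)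
      with diamond-≤ n (m+n≤o⇒m≤o _ b) r r′ | diamondᵐ-≤ n (m+n≤o⇒n≤o (size t) b) rs rs′
    ... | _ , p , p′ | _ , q , q′ = _ , des p q , des p′ q′
    diamond-≤ n b (step R∈ eq rs) (des r′ rs′) = diamond-step-des n b R∈ eq rs r′ rs′
    diamond-≤ n b (des r rs) (step R∈ eq rs′) with diamond-step-des n b R∈ eq rs′ r rs
    ... | w , q , q′ = w , q′ , q
    -- Two contractions of one term use the same rule and the same `v`, so it remains to join the
    -- two reducts of `v` beneath the common right-hand side.
    diamond-≤ n b (step {R} {v = v} R∈ refl rs) (step {v = v′} R′∈ eq′ rs′)
      with redex-unique 𝕋 R∈ R′∈ v v′ eq′
    ... | refl with redex-injective R v v′ eq′
    ... | refl with diamond-redex n R v b rs rs′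
    ... | _ , q , q′ = _ , ⇛-msub q _ _ (rhs R) , ⇛-msub q′ _ _ (rhs R)

    -- The reduction of the arguments leaves a redex of the same rule, so the contraction can still
    -- be performed after it.
    diamond-step-des : ∀ n {R v v′} {d : des ξ ∈ S} {t u : Tm S θ γ} {ts us} →
                       size (des d t ts) ≤ n → R ∈ rewrites 𝕋 → des d t ts ≡ redex R v →
                       v ⇛ᵐ v′ → t ⇛ u → ts ⇛ᵐ us →
                       ∃[ w ] (rhs R [ v′ ] ⇛ w) × (des d u us ⇛ w)
    diamond-step-des n {R} {v} b R∈ eq rs r′ rs′ with redex-⇛ R v eq r′ rs′
    ... | _ , eq′ , rs″ with diamond-redex n R v (subst (λ s → size s ≤ n) eq b) rs rs″
    ... | _ , q , q′ = _ , ⇛-msub q _ _ (rhs R) , step R∈ eq′ q′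

    -- The reduction of `v` produced by `redex-⇛` is no subderivation of the given one, so the bound
    -- has to drop here.
    diamond-redex : ∀ n R (v : MSub S θ γ (scope R)) {v′ v″} → size (redex R v) ≤ n →
                    v ⇛ᵐ v′ → v ⇛ᵐ v″ → ∃[ w ] (v′ ⇛ᵐ w) × (v″ ⇛ᵐ w)
    diamond-redex zero    R v b rs rs′ = contradiction (≤-trans (size-redex R v) b) λ ()
    diamond-redex (suc n) R v b rs rs′ =
      diamondᵐ-≤ n (s≤s⁻¹ (≤-trans (size-redex R v) b)) rs rs′

    diamondˢ-≤ : ∀ n {ts us us′ : Sub S θ γ δ} → sizeˢ ts ≤ n → ts ⇛ˢ us → ts ⇛ˢ us′ →
                 ∃[ ws ] (us ⇛ˢ ws) × (us′ ⇛ˢ ws)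
    diamondˢ-≤ n b ε ε = ε , ε , ε
    diamondˢ-≤ n {ts ▸ t} b (rs ▸ r) (rs′ ▸ r′)
      with diamondˢ-≤ n (m+n≤o⇒m≤o _ b) rs rs′ | diamond-≤ n (m+n≤o⇒n≤o (sizeˢ ts) b) r r′
    ... | _ , q , q′ | _ , p , p′ = _ , q ▸ p , q′ ▸ p′

    diamondᵐ-≤ : ∀ n {ts us us′ : MSub S θ γ ξ} → sizeᵐ ts ≤ n → ts ⇛ᵐ us → ts ⇛ᵐ us′ →
                 ∃[ ws ] (us ⇛ᵐ ws) × (us′ ⇛ᵐ ws)
    diamondᵐ-≤ n b ε ε = ε , ε , ε
    diamondᵐ-≤ n {ts ▸ t} b (rs ▸ r) (rs′ ▸ r′)
      with diamondᵐ-≤ n (m+n≤o⇒m≤o _ b) rs rs′ | diamond-≤ n (m+n≤o⇒n≤o (sizeᵐ ts) b) r r′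
    ... | _ , q , q′ | _ , p , p′ = _ , q ▸ p , q′ ▸ p′

  diamond : {t u u′ : Tm S θ γ} → t ⇛ u → t ⇛ u′ → ∃[ w ] (u ⇛ w) × (u′ ⇛ w)
  diamond = diamond-≤ _ ≤-refl

  -- A single parallel step on one side suffices, because conversions are consumed one step at a
  -- time.
  strip : {t u s : Tm S θ γ} → t ⇛ u → Star _⇛_ t s → ∃[ w ] Star _⇛_ u w × (s ⇛ w)
  strip r ε         = _ , ε , r
  strip r (r′ ◅ rs) with diamond r r′
  ... | _ , q , q′ with strip q′ rs
  ... | w , qs , q″ = w , q ◅ qs , q″

-- Conversion, matching and completeness

module Completeness {S : Sig} (𝕋 : Theory S) where

  open Judgments 𝕋
  open ParallelReduction 𝕋

  _⟶ᵐ*_ : MSub S θ γ ξ → MSub S θ γ ξ → Set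
  _⟶ᵐ*_ = Star _⟶ᵐ_

  mutual
    ⟶-ren : (ρ : Ren γ γ′) {t u : Tm S θ γ} → t ⟶ u → ren ρ t ⟶ ren ρ u
    ⟶-ren ρ (step {R} R∈ v) =
      subst₂ _⟶_ (sym (ren-[] ρ v (lhs R))) (sym (ren-[] ρ v (rhs R))) (step R∈ (renMSub ρ v))
    ⟶-ren ρ (mvar r) = mvar (⟶ˢ-ren ρ r)
    ⟶-ren ρ (con r)  = con (⟶ᵐ-ren ρ r)
    ⟶-ren ρ (des₁ r) = des₁ (⟶-ren ρ r)
    ⟶-ren ρ (des₂ r) = des₂ (⟶ᵐ-ren ρ r)

    ⟶ˢ-ren : (ρ : Ren γ γ′) {ts us : Sub S θ γ δ} → ts ⟶ˢ us → renSub ρ ts ⟶ˢ renSub ρ us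
    ⟶ˢ-ren ρ (left r)  = left (⟶ˢ-ren ρ r)
    ⟶ˢ-ren ρ (right r) = right (⟶-ren ρ r)

    ⟶ᵐ-ren : (ρ : Ren γ γ′) {ts us : MSub S θ γ ξ} → ts ⟶ᵐ us → renMSub ρ ts ⟶ᵐ renMSub ρ us
    ⟶ᵐ-ren ρ (left r)  = left (⟶ᵐ-ren ρ r)
    ⟶ᵐ-ren ρ (right r) = right (⟶-ren (liftRen _ ρ) r)

  -- A single step touches one entry, hence one half only. This is why one step in `v` remains one
  -- step in a linear instance.
  ⟶ᵐ-split : ∀ θ₂ {v w : MSub S θ δ (θ₂ ++ θ₁)} → v ⟶ᵐ w →
             (outer θ₂ v ⟶ᵐ outer θ₂ w × inner θ₂ v ≡ inner θ₂ w) ⊎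
             (outer θ₂ v ≡ outer θ₂ w × inner θ₂ v ⟶ᵐ inner θ₂ w)
  ⟶ᵐ-split []       r         = inj₁ (r , refl)
  ⟶ᵐ-split (_ ∷ θ₂) (right r) = inj₂ (refl , right r)
  ⟶ᵐ-split (_ ∷ θ₂) (left r) with ⟶ᵐ-split θ₂ r
  ... | inj₁ (r′ , eq) = inj₁ (r′ , cong (_▸ _) eq)
  ... | inj₂ (eq , r′) = inj₂ (eq , left r′)

  mutual
    ⟶-inst : (p : TmP S θ γ) {v w : MSub S θ′ δ θ} → v ⟶ᵐ w → inst p v ⟶ inst p w
    ⟶-inst mvar       {ε ▸ _} {ε ▸ _} (right r) = r
    ⟶-inst (con c ps) r = con (⟶-instᵐ ps r)

    ⟶-instᵐ : (ps : MSubP S θ γ ξ) {v w : MSub S θ′ δ θ} → v ⟶ᵐ w → instᵐ ps v ⟶ᵐ instᵐ ps w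
    ⟶-instᵐ (_▸_ {θ₂ = θ₂} ps p) {v} {w} r with ⟶ᵐ-split θ₂ r
    ... | inj₁ (r′ , eq) rewrite eq = left (⟶-instᵐ ps r′)
    ... | inj₂ (eq , r′) rewrite eq = right (⟶-ren _ (⟶-inst p r′))

  ⟶-redex : (R : Rewrite S) {v w : MSub S θ δ (scope R)} → v ⟶ᵐ w → redex R v ⟶ redex R w
  ⟶-redex (rewr {θts = θts} d p ps r) s with ⟶ᵐ-split θts s
  ... | inj₁ (s′ , eq) rewrite eq = des₁ (⟶-inst p s′)
  ... | inj₂ (eq , s′) rewrite eq = des₂ (⟶-instᵐ ps s′)

  mutual
    ⟶⊆⇛ : {t u : Tm S θ γ} → t ⟶ u → t ⇛ u
    ⟶⊆⇛ (step {R} R∈ v)     = step R∈ (lhs-[] R v) (⇛ᵐ-refl v)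
    ⟶⊆⇛ (mvar r)            = mvar (⟶ˢ⊆⇛ˢ r)
    ⟶⊆⇛ (con r)             = con (⟶ᵐ⊆⇛ᵐ r)
    ⟶⊆⇛ (des₁ {ts = ts} r)  = des (⟶⊆⇛ r) (⇛ᵐ-refl ts)
    ⟶⊆⇛ (des₂ {t = t} r)    = des (⇛-refl t) (⟶ᵐ⊆⇛ᵐ r)

    ⟶ˢ⊆⇛ˢ : {ts us : Sub S θ γ δ} → ts ⟶ˢ us → ts ⇛ˢ us
    ⟶ˢ⊆⇛ˢ (left {t = t} r)    = ⟶ˢ⊆⇛ˢ r ▸ ⇛-refl t
    ⟶ˢ⊆⇛ˢ (right {ts = ts} r) = ⇛ˢ-refl ts ▸ ⟶⊆⇛ r

    ⟶ᵐ⊆⇛ᵐ : {ts us : MSub S θ γ ξ} → ts ⟶ᵐ us → ts ⇛ᵐ us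
    ⟶ᵐ⊆⇛ᵐ (left {t = t} r)    = ⟶ᵐ⊆⇛ᵐ r ▸ ⇛-refl t
    ⟶ᵐ⊆⇛ᵐ (right {ts = ts} r) = ⇛ᵐ-refl ts ▸ ⟶⊆⇛ r

  mutual
    ⇛⊆⟶* : {t u : Tm S θ γ} → t ⇛ u → t ⟶* u
    ⇛⊆⟶* (var x)   = ε
    ⇛⊆⟶* (mvar rs) = Star.gmap (mvar _) mvar (⇛ˢ⊆⟶ˢ* rs)
    ⇛⊆⟶* (con rs)  = Star.gmap (con _) con (⇛ᵐ⊆⟶ᵐ* rs)
    ⇛⊆⟶* (des {ts = ts} r rs) =
      Star.gmap (λ t → des _ t ts) des₁ (⇛⊆⟶* r) ◅◅ Star.gmap (des _ _) des₂ (⇛ᵐ⊆⟶ᵐ* rs)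
    -- The substitution is reduced inside the redex first, then the rule is contracted.
    ⇛⊆⟶* (step {R} {v′ = v′} R∈ refl rs) =
      Star.gmap (redex R) (⟶-redex R) (⇛ᵐ⊆⟶ᵐ* rs)
        ◅◅ subst (_⟶ rhs R [ v′ ]) (lhs-[] R v′) (step R∈ v′) ◅ ε

    ⇛ˢ⊆⟶ˢ* : {ts us : Sub S θ γ δ} → ts ⇛ˢ us → Star _⟶ˢ_ ts us
    ⇛ˢ⊆⟶ˢ* ε = ε
    ⇛ˢ⊆⟶ˢ* (rs ▸ r) = Star.gmap (_▸ _) left (⇛ˢ⊆⟶ˢ* rs) ◅◅ Star.gmap (_ ▸_) right (⇛⊆⟶* r)

    ⇛ᵐ⊆⟶ᵐ* : {ts us : MSub S θ γ ξ} → ts ⇛ᵐ us → ts ⟶ᵐ* us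
    ⇛ᵐ⊆⟶ᵐ* ε = ε
    ⇛ᵐ⊆⟶ᵐ* (rs ▸ r) = Star.gmap (_▸ _) left (⇛ᵐ⊆⟶ᵐ* rs) ◅◅ Star.gmap (_ ▸_) right (⇛⊆⟶* r)

  church-rosser : {t u : Tm S θ γ} → t ≃ u → ∃[ w ] (t ⟶* w) × (u ⟶* w)
  church-rosser t≃u with joinable t≃u
    where
    joinable : {t u : Tm S θ γ} → t ≃ u → ∃[ w ] Star _⇛_ t w × Star _⇛_ u w
    joinable ε = _ , ε , ε
    joinable (fwd r ◅ rs) with joinable rs
    ... | w , q , q′ = w , ⟶⊆⇛ r ◅ q , q′
    -- A backward step creates a peak at the next term; `strip` closes it and moves the common
    -- reduct on by one parallel step.
    joinable (bwd r ◅ rs) with joinable rs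
    ... | w , q , q′ with strip (⟶⊆⇛ r) q
    ... | w′ , p , p′ = w′ , p , q′ ◅◅ p′ ◅ ε
  ... | w , q , q′ = w , Star.kleisliStar id ⇛⊆⟶* q , Star.kleisliStar id ⇛⊆⟶* q′

  -- Conversion as a congruence

  ≃-sym : {t u : Tm S θ γ} → t ≃ u → u ≃ t
  ≃-sym = symmetric _⟶_

  ⟶*⇒≃ : {t u : Tm S θ γ} → t ⟶* u → t ≃ u
  ⟶*⇒≃ = Star.map fwd

  ≃-ren : (ρ : Ren γ γ′) {t u : Tm S θ γ} → t ≃ u → ren ρ t ≃ ren ρ u
  ≃-ren ρ = gmap (ren ρ) (⟶-ren ρ)

  ≃ᵐ-▸ : {ts us : MSub S θ γ ξ} {t u : Tm S θ (δ + γ)} → ts ≃ᵐ us → t ≃ u → ts ▸ t ≃ᵐ us ▸ u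
  ≃ᵐ-▸ rs r = gmap (_▸ _) left rs ◅◅ gmap (_ ▸_) right r

  ≃ᵐ-▸⁻ : {ts us : MSub S θ γ ξ} {t u : Tm S θ (δ + γ)} → ts ▸ t ≃ᵐ us ▸ u → ts ≃ᵐ us × t ≃ u
  ≃ᵐ-▸⁻ ε = ε , ε
  ≃ᵐ-▸⁻ (fwd (left r)  ◅ rs) with ≃ᵐ-▸⁻ rs
  ... | q , p = fwd r ◅ q , p
  ≃ᵐ-▸⁻ (fwd (right r) ◅ rs) with ≃ᵐ-▸⁻ rs
  ... | q , p = q , fwd r ◅ p
  ≃ᵐ-▸⁻ (bwd (left r)  ◅ rs) with ≃ᵐ-▸⁻ rs
  ... | q , p = bwd r ◅ q , p
  ≃ᵐ-▸⁻ (bwd (right r) ◅ rs) with ≃ᵐ-▸⁻ rs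
  ... | q , p = q , bwd r ◅ p

  ≃ᵐ-⊹ : {v v′ : MSub S θ δ θ₁} {w w′ : MSub S θ δ θ₂} → v ≃ᵐ v′ → w ≃ᵐ w′ → v ⊹ w ≃ᵐ v′ ⊹ w′
  ≃ᵐ-⊹ {w = ε}     {ε}       rs rs′ = rs
  ≃ᵐ-⊹ {w = w ▸ t} {w′ ▸ t′} rs rs′ =
    ≃ᵐ-▸ (≃ᵐ-⊹ rs (proj₁ (≃ᵐ-▸⁻ rs′))) (proj₂ (≃ᵐ-▸⁻ rs′))

  ≃ᵐ-⊹⁻ : {v v′ : MSub S θ δ θ₁} {w w′ : MSub S θ δ θ₂} → v ⊹ w ≃ᵐ v′ ⊹ w′ → v ≃ᵐ v′ × w ≃ᵐ w′
  ≃ᵐ-⊹⁻ {w = ε}     {ε}       rs = rs , ε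
  ≃ᵐ-⊹⁻ {w = w ▸ t} {w′ ▸ t′} rs with ≃ᵐ-▸⁻ rs
  ... | q , p with ≃ᵐ-⊹⁻ {w = w} {w′} q
  ... | q₁ , q₂ = q₁ , ≃ᵐ-▸ q₂ p

  -- `t` may duplicate entries, so one step in `v` becomes a sequence of steps; parallel reduction
  -- supplies it.
  ≃-msub : {v w : MSub S θ′ δ θ} → v ≃ᵐ w → (ρ : Ren δ γ′) (τ : Ren γ γ′) (t : Tm S θ γ) →
           msub v ρ τ t ≃ msub w ρ τ t
  ≃-msub v≃w ρ τ t = gfold (isEquivalence _⟶_) (λ v → msub v ρ τ t)
    (λ r → ⟶*⇒≃ (⇛⊆⟶* (⇛-msub (⟶ᵐ⊆⇛ᵐ r) ρ τ t))) v≃w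

  ≃ᵐ-msubMSub : {v w : MSub S θ′ δ θ} → v ≃ᵐ w → (ρ : Ren δ γ′) (τ : Ren γ γ′)
                (ts : MSub S θ γ ξ) → msubMSub v ρ τ ts ≃ᵐ msubMSub w ρ τ ts
  ≃ᵐ-msubMSub v≃w ρ τ ε        = ε
  ≃ᵐ-msubMSub v≃w ρ τ (ts ▸ t) = ≃ᵐ-▸ (≃ᵐ-msubMSub v≃w ρ τ ts) (≃-msub v≃w _ _ t)

  -- Left-hand sides are headed by destructors, so a constructor can only reduce in its arguments.
  con-⟶* : {c : con ξ ∈ S} {ts : MSub S θ γ ξ} {u : Tm S θ γ} → con c ts ⟶* u →
           ∃[ us ] u ≡ con c us × ts ⟶ᵐ* us
  con-⟶* ε = _ , refl , ε
  con-⟶* (con r ◅ rs) with con-⟶* rs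
  ... | us , eq , q = us , eq , r ◅ q

  mutual
    match-complete : (p : TmP S θ γ) (w : MSub S [] δ θ) {u : Tm S [] (γ + δ)} →
                     u ≃ inst p w → ∃[ v ] (p ≺ u ⇝ v) × (v ≃ᵐ w)
    match-complete mvar       (ε ▸ t) {u} u≃t = ε ▸ u , mvar , ≃ᵐ-▸ ε u≃t
    -- The common reduct still has head `c`, as it is also reached from the instance. It is thus the
    -- constructor form that matching demands of `u`, with arguments convertible to those of the
    -- instance.
    match-complete (con c ps) w u≃ with church-rosser u≃
    ... | _ , u⟶* , inst⟶* with con-⟶* inst⟶*
    ... | us , refl , q with matchᵐ-complete ps w (symmetric _⟶ᵐ_ (Star.map fwd q))
    ... | v , m , v≃w = v , con u⟶* m , v≃w

    matchᵐ-complete : (ps : MSubP S θ γ ξ) (w : MSub S [] δ θ) {us : MSub S [] (γ + δ) ξ} →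
                      us ≃ᵐ instᵐ ps w → ∃[ v ] (ps ≺ᵐ us ⇝ v) × (v ≃ᵐ w)
    matchᵐ-complete ε ε {ε} _ = ε , ε , ε
    matchᵐ-complete {γ = γ} {δ = δ} (_▸_ {θ₂ = θ₂} {δ = β} ps p) w {us ▸ u} us≃
      with matchᵐ-complete ps (outer θ₂ w) (proj₁ (≃ᵐ-▸⁻ us≃))
         | match-complete p (inner θ₂ w)
             (subst (_ ≃_) (ren-assocˡ-assocʳ β γ δ _) (≃-ren (assocˡ β γ δ) (proj₂ (≃ᵐ-▸⁻ us≃))))
    ... | v₁ , m₁ , v₁≃ | v₂ , m₂ , v₂≃ =
      v₁ ⊹ v₂ , ext m₁ m₂ , subst (v₁ ⊹ v₂ ≃ᵐ_) (outer⊹inner θ₂ w) (≃ᵐ-⊹ v₁≃ v₂≃)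

  match-instance : (p : TmP S θ 0) (w : MSub S [] δ θ) {u : Tm S [] δ} →
                   ⌊ p ⌋ [ w ] ≃ u → ∃[ v ] (p ≺ u ⇝ v) × (v ≃ᵐ w)
  match-instance p w eq = match-complete p w (subst (_ ≃_) ([]-pattern p w) (≃-sym eq))

  -- Contexts up to conversion and completeness of typing

  infix 4 _≃ᶜ_

  data _≃ᶜ_ {γ : Scope} : Ctx S θ γ γ′ → Ctx S θ γ γ′ → Set where
    ε   : Ctx.ε {S = S} {θ = θ} ≃ᶜ ε
    _▸_ : {Γ Γ′ : Ctx S θ γ γ′} {T T′ : Tm S θ γ′} → Γ ≃ᶜ Γ′ → T ≃ T′ → Γ ▸ T ≃ᶜ Γ′ ▸ T′

  ≃ᶜ-refl : (Γ : Ctx S θ γ γ′) → Γ ≃ᶜ Γ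
  ≃ᶜ-refl ε       = ε
  ≃ᶜ-refl (Γ ▸ T) = ≃ᶜ-refl Γ ▸ ε

  ≃-lookupVar : {Γ Γ′ : Ctx S θ 0 γ} → Γ ≃ᶜ Γ′ → ∀ x → lookupVar Γ x ≃ lookupVar Γ′ x
  ≃-lookupVar (Γ≃ ▸ T≃) zero    = ≃-ren suc T≃
  ≃-lookupVar (Γ≃ ▸ T≃) (suc x) = ≃-ren suc (≃-lookupVar Γ≃ x)

  ≃ᶜ-⊹ᶜ-[] : {Γ Γ′ : Ctx S θ 0 γ} {v v′ : MSub S θ γ ξ} → Γ ≃ᶜ Γ′ → v ≃ᵐ v′ →
             (Δ : Ctx S ξ 0 δ) → Γ ⊹ᶜ Δ [ v ]ᶜ ≃ᶜ Γ′ ⊹ᶜ Δ [ v′ ]ᶜ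
  ≃ᶜ-⊹ᶜ-[] Γ≃ v≃ ε       = Γ≃
  ≃ᶜ-⊹ᶜ-[] Γ≃ v≃ (Δ ▸ T) = ≃ᶜ-⊹ᶜ-[] Γ≃ v≃ Δ ▸ ≃-msub v≃ _ _ T

  -- In the destructor rule the typing of the principal argument lies beneath those of the remaining
  -- ones; peeling them off exposes it.
  typed-prefix : {Θ : MCtx S θ} {Γ : Ctx S θ 0 γ} {Ψ : MCtx S θ₁} {v : MSub S θ γ θ₁}
                 (Ξ : MTel S θ₁ ξ) (ts : MSub S θ γ ξ) →
                 Θ ∣ Γ ⊢ᵐ v ⊹ ts ∶ Ψ ⊹ˣ Ξ → Θ ∣ Γ ⊢ᵐ v ∶ Ψ
  typed-prefix ε           ε        D         = D
  typed-prefix (Ξ ▸ _ ∶ _) (ts ▸ _) (ext D _) = typed-prefix Ξ ts D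

  -- Matching returns one list, while the bidirectional `cons` wants it literally as `tp ⊹ ti`; the
  -- existential form allows a match on `refl`.
  split-⊹ : ∀ θ₂ (v : MSub S θ δ (θ₂ ++ θ₁)) → ∃[ v₁ ] ∃[ v₂ ] v ≡ v₁ ⊹ v₂
  split-⊹ θ₂ v = outer θ₂ v , inner θ₂ v , sym (outer⊹inner θ₂ v)

  -- Types and contexts are only required to be convertible: the arguments
  -- recovered by matching agree with the declarative ones up to ≃ only.
  mutual
    infer : (t : TmI S γ) {Γ Γ′ : Ctx S [] 0 γ} {T : Tm S [] γ} → AscFreeⁱ t → Γ ≃ᶜ Γ′ →
            ε ∣ Γ ⊢ ⌜ t ⌝ⁱ ∶ T → ∃[ U ] (Γ′ ⊢ t ⇒ U) × (T ≃ U)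
    infer (var x) a Γ≃ (var .x _) = _ , var x , ≃-lookupVar Γ≃ x
    infer (var x) a Γ≃ (conv D T≃ _) with infer (var x) a Γ≃ D
    ... | U , D′ , T≃U = U , D′ , ≃-sym T≃ ◅◅ T≃U
    infer (des d t us) (at , aus) Γ≃ (dest {T = T} {Ξd} {U} {tpi} decl D)
      with typed-prefix Ξd ⌜ us ⌝ᵐ D
    ... | ext _ Dt with infer t at Γ≃ Dt
    -- The principal argument is declaratively typed at the instance of the pattern by `tpi`, so the
    -- inferred type, being convertible to it, must match.
    ... | T′ , t⇒ , T≃ with match-instance T tpi T≃
    ... | v , m , v≃ =
      _ , dest decl t⇒ m (checkᵐ us aus Γ≃ tpi≃ D)
        , ≃-msub (≃ᵐ-⊹ {w = ⌜ us ⌝ᵐ} tpi≃ ε) _ _ U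
      where
      tpi≃ : tpi ▸ ⌜ t ⌝ⁱ ≃ᵐ v ▸ ⌜ t ⌝ⁱ
      tpi≃ = ≃ᵐ-▸ (symmetric _⟶ᵐ_ v≃) ε
    infer (des d t us) a Γ≃ (conv D T≃ _) with infer (des d t us) a Γ≃ D
    ... | U , D′ , T≃U = U , D′ , ≃-sym T≃ ◅◅ T≃U

    check : (t : TmC S γ) {Γ Γ′ : Ctx S [] 0 γ} {T T′ : Tm S [] γ} → AscFreeᶜ t → Γ ≃ᶜ Γ′ →
            T ≃ T′ → ε ∣ Γ ⊢ ⌜ t ⌝ᶜ ∶ T → Γ′ ⊢ t ⇐ T′
    check (con c us) a Γ≃ T≃ (cons {θp} {ξi = ξi} {vi = vi} {T = T} {tp} decl D _)
      with match-instance T (tp ⊹ vi [ tp ⊹ ⌜ us ⌝ᵐ ]ᵐ) T≃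
    ... | v , m , v≃ with split-⊹ ξi v
    ... | tp′ , ti′ , refl with ≃ᵐ-⊹⁻ {v = tp′} {tp} {ti′} v≃
    ... | tp≃ , ti≃ =
      cons decl m (checkᵐ us a Γ≃ (symmetric _⟶ᵐ_ tp≃) D)
        -- Matching relates `ti′` to `vi` at the declarative parameters `tp`; the rule asks for `vi`
        -- at the matched ones `tp′`.
        (ti≃ ◅◅ ≃ᵐ-msubMSub (≃ᵐ-⊹ {w = ⌜ us ⌝ᵐ} (symmetric _⟶ᵐ_ tp≃) ε) _ _ vi)
    check (con c us) a Γ≃ T≃ (conv D U≃ _) = check (con c us) a Γ≃ (U≃ ◅◅ T≃) D
    check (underline t) a Γ≃ T≃ D with infer t a Γ≃ D
    ... | U , t⇒ , T≃U = switch t⇒ (≃-sym T≃U ◅◅ T≃)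

    checkᵐ : (ts : MSubC S γ ξ) {Γ Γ′ : Ctx S [] 0 γ} {v v′ : MSub S [] γ θ} {Θ : MCtx S θ}
             {Ξ : MTel S θ ξ} → AscFreeᵐ ts → Γ ≃ᶜ Γ′ → v ≃ᵐ v′ →
             ε ∣ Γ ⊢ᵐ v ⊹ ⌜ ts ⌝ᵐ ∶ Θ ⊹ˣ Ξ → Γ′ ∣ v′ ∶ Θ ⊢ ts ⇐ Ξ
    checkᵐ ε        {Ξ = ε}         a        Γ≃ v≃ D = ε
    checkᵐ (ts ▸ t) {Ξ = Ξ ▸ Δ ∶ T} (as , a) Γ≃ v≃ (ext Ds D) =
      -- Here the contexts diverge: `Δ` is instantiated by `v` on one side and by `v′` on the other.
      ext (checkᵐ ts as Γ≃ v≃ Ds) (check t a (≃ᶜ-⊹ᶜ-[] Γ≃ vts≃ Δ) (≃-msub vts≃ _ _ T) D)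
      where vts≃ = ≃ᵐ-⊹ {w = ⌜ ts ⌝ᵐ} v≃ ε

  -- Sorts are headed by constructors, whereas an inferable term could erase to a constructor only
  -- through an ascription.
  ¬-inferable-sort : (t : TmI S γ) {Γ : Ctx S [] 0 γ} → AscFreeⁱ t → ¬ (ε ∣ Γ ⊢ ⌜ t ⌝ⁱ sort)
  ¬-inferable-sort (var x)      a ()
  ¬-inferable-sort (des d t us) a ()

  check-sort : (T : TmC S γ) {Γ : Ctx S [] 0 γ} → AscFreeᶜ T →
               ε ∣ Γ ⊢ ⌜ T ⌝ᶜ sort → Γ ⊢ T ⇐sort
  check-sort (con c us)    a (sort decl D) = sort decl (checkᵐ us a (≃ᶜ-refl _) ε D)
  check-sort (underline t) a D             = contradiction D (¬-inferable-sort t a)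

corollary4p15 : ∀ {S : Sig} (𝕋 : Theory S) {γ : Scope} (Γ : Ctx S [] 0 γ) →
    let open Judgments 𝕋 in
    (∀ (t : TmI S γ) (T : Tm S [] γ) → AscFreeⁱ t →
    ε ∣ Γ ⊢ ⌜ t ⌝ⁱ ∶ T → ∃[ U ] (Γ ⊢ t ⇒ U) × (T ≃ U))
    × (∀ (t : TmC S γ) (T : Tm S [] γ) → AscFreeᶜ t →
    ε ∣ Γ ⊢ ⌜ t ⌝ᶜ ∶ T → Γ ⊢ t ⇐ T)
    × (∀ (T : TmC S γ) → AscFreeᶜ T →
    ε ∣ Γ ⊢ ⌜ T ⌝ᶜ sort → Γ ⊢ T ⇐sort)
    × (∀ {θ ξ : MScope} (Θ : MCtx S θ) (Ξ : MTel S θ ξ)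
    (v : MSub S [] γ θ) (ts : MSubC S γ ξ) → AscFreeᵐ ts →
    ε ∣ Γ ⊢ᵐ v ⊹ ⌜ ts ⌝ᵐ ∶ Θ ⊹ˣ Ξ → Γ ∣ v ∶ Θ ⊢ ts ⇐ Ξ)
corollary4p15 𝕋 Γ =
    (λ t T a → infer t a (≃ᶜ-refl Γ))
  , (λ t T a → check t a (≃ᶜ-refl Γ) ε)
  , (λ T a → check-sort T a)
  , (λ Θ Ξ v ts a → checkᵐ ts a (≃ᶜ-refl Γ) ε)
  where open Completeness 𝕋
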